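{- (a) Let $G$ be a maximal outerplanar graph of order $n\ge 3$. If $I$ is a nondecreasing distance-based topological index, then $I(G)\le I(P_n^2)$; if $I$ is a nonincreasing distance-based topological index, then $I(G)\ge I(P_n^2)$. (b) Let $G$ be an Apollonian network of order $n\ge 3$. If $I$ is a nondecreasing distance-based topological index, then $I(G)\le I(P_n^3)$; if $I$ is a nonincreasing distance-based topological index, then $I(G)\ge I(P_n^3)$.
   Context: All graphs are finite and simple. The order of a graph is its number of vertices. A graph is outerplanar if it can be embedded in the plane such that no two edges intersect and every vertex is on the boundary of the outer face; it is maximal outerplanar if it is outerplanar but after adding any edge it no longer has this property. Apollonian networks (planar $3$-trees) are the planar graphs obtained from a triangle by successively (zero or more times) inserting a new vertex into a face of length three and joining the new vertex to the three vertices on this face by edges. $P_n$ is the path on $n$ vertices. The $k$-th power $G^k$ of a graph $G$ is the graph on the same vertex set in which two distinct vertices are adjacent if their distance in $G$ is at most $k$. For a connected graph $G$, $d_G(u,v)$ is the usual shortest-path distance. The distance sequence $\mathcal{D}(G)$ of a connected graph $G$ is the nondecreasing sequence (of length $\binom{n}{2}$ if $G$ has order $n$) of the distances between all unordered pairs of distinct vertices of $G$, with repetitions. A topological index $I$, assigning a real number to each connected graph, is distance-based if it can be expressed in the form $I(G)=g(\mathcal{D}(G))$, where $g$ is a real-valued function defined on the set of all finite sequences of positive integers. It is called nondecreasing (nonincreasing) if $g$, when restricted to sequences of any fixed length, is nondecreasing (nonincreasing) in every coordinate. -}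

module Defs where

open import Data.Empty using (⊥)
open import Data.Fin.Base as Fin using (Fin; zero; suc; toℕ)
import Data.Fin.Properties as Fin
open import Data.Irrelevant using ([_])
open import Data.List.Base using (List; []; _∷_; _++_; map; mapMaybe; cartesianProduct; allFin)
open import Data.List.Membership.Propositional using (_∈_; _∉_)
open import Data.List.Relation.Binary.Permutation.Propositional using (_↭_)
import Data.List.Sort as Sort
import Data.Maybe.Base as Maybe
open import Data.Nat.Base using (ℕ; zero; suc; z≤n; s≤s; NonZero; ∣_-_∣; >-nonZero⁻¹) renaming (_≤_ to _≤ⁿ_; _<_ to _<ⁿ_)
import Data.Nat.Properties as ℕ
open import Data.Product.Base using (∃; ∃-syntax; Σ; Σ-syntax; _×_; _,_; proj₁; proj₂)
open import Data.Rational.Base using (ℚ) renaming (_<_ to _<ᵠ_)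
open import Data.Refinement.Base using (Refinement-syntax; _,_; value)
open import Data.Sum.Base using (_⊎_; inj₁; inj₂; [_,_]′)
open import Function.Base using (_∘_)
open import Function.Bundles using (_⇔_)
open import Relation.Binary.Bundles using (DecTotalOrder)
import Relation.Binary.Construct.On as On
open import Relation.Binary.PropositionalEquality using (_≡_; _≢_; refl; sym; trans; cong; subst)
open import Relation.Nullary.Decidable using (Dec; yes; no; ¬?; _×-dec_; _⊎-dec_; dec⇒maybe)
open import Relation.Nullary.Negation using (¬_; contradiction)

-- Two-sided located Dedekind cuts.
record ℝ : Set₁ where
  field
    L U          : ℚ → Set
    L-inhabited  : ∃[ p ] L p
    U-inhabited  : ∃[ p ] U p
    L-downward   : ∀ {p q} → p <ᵠ q → L q → L p
    U-upward     : ∀ {p q} → p <ᵠ q → U p → U q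
    L-open       : ∀ {p} → L p → ∃[ q ] (p <ᵠ q × L q)
    U-open       : ∀ {q} → U q → ∃[ p ] (p <ᵠ q × U p)
    disjoint     : ∀ {p} → L p → U p → ⊥
    located      : ∀ {p q} → p <ᵠ q → L p ⊎ U q

infix 4 _≤_ _≥_ _≈_

_≤_ _≥_ _≈_ : ℝ → ℝ → Set
x ≤ y = ∀ {p} → ℝ.L x p → ℝ.L y p
x ≥ y = y ≤ x
x ≈ y = x ≤ y × y ≤ x

record Graph (n : ℕ) : Set₁ where
  field
    Adj    : Fin n → Fin n → Set
    adj?   : ∀ u v → Dec (Adj u v)
    symm   : ∀ {u v} → Adj u v → Adj v u
    irrefl : ∀ {u} → ¬ Adj u u

open Graph

addEdge : ∀ {n} (G : Graph n) (u v : Fin n) → u ≢ v → Graph n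
addEdge G u v u≢v = record
  { Adj    = λ x y → Adj G x y ⊎ ((x ≡ u × y ≡ v) ⊎ (x ≡ v × y ≡ u))
  ; adj?   = λ x y → adj? G x y ⊎-dec
                     (((x Fin.≟ u) ×-dec (y Fin.≟ v)) ⊎-dec
                      ((x Fin.≟ v) ×-dec (y Fin.≟ u)))
  ; symm   = λ { (inj₁ a)               → inj₁ (symm G a)
               ; (inj₂ (inj₁ (p , q))) → inj₂ (inj₂ (q , p))
               ; (inj₂ (inj₂ (p , q))) → inj₂ (inj₁ (q , p)) }
  ; irrefl = λ { (inj₁ a)               → irrefl G a
               ; (inj₂ (inj₁ (p , q))) → u≢v (trans (sym p) q)
               ; (inj₂ (inj₂ (p , q))) → u≢v (trans (sym q) p) }
  }

Walk : ∀ {n} → Graph n → ℕ → Fin n → Fin n → Set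
Walk G zero    u v = u ≡ v
Walk G (suc k) u v = ∃[ w ] (Adj G u w × Walk G k w v)

Connected : ∀ {n} → Graph n → Set
Connected G = ∀ u v → ∃[ k ] Walk G k u v

record ConnectedGraph : Set₁ where
  constructor ⟨_,_⟩
  field
    {order}   : ℕ
    graph     : Graph order
    connected : Connected graph

open ConnectedGraph

walk? : ∀ {n} (G : Graph n) k u v → Dec (Walk G k u v)
walk? G zero    u v = u Fin.≟ v
walk? G (suc k) u v = Fin.any? λ w → adj? G u w ×-dec walk? G k w v

snoc : ∀ {n} (G : Graph n) k {u v w} → Walk G k u v → Adj G v w → Walk G (suc k) u w
snoc G zero    refl        b = _ , b , refl
snoc G (suc k) (x , a , p) b = x , a , snoc G k p b

reverse : ∀ {n} (G : Graph n) k {u v} → Walk G k u v → Walk G k v u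
reverse G zero    refl        = refl
reverse G (suc k) (x , a , p) = snoc G k (reverse G k p) (symm G a)

mapWalk : ∀ {m n} (G : Graph m) (H : Graph n) (f : Fin m → Fin n) →
          (∀ {u v} → Adj G u v → Adj H (f u) (f v)) →
          ∀ k {u v} → Walk G k u v → Walk H k (f u) (f v)
mapWalk G H f φ zero    refl        = refl
mapWalk G H f φ (suc k) (x , a , p) = f x , φ a , mapWalk G H f φ k p

least : {P : ℕ → Set} → (∀ k → Dec (P k)) → ∀ m → P m →
        ∃[ k ] (P k × (∀ j → P j → k ≤ⁿ j))
least P? m p with P? 0
least P? m       p | yes p₀ = 0 , p₀ , λ _ _ → z≤n
least P? zero    p | no ¬p₀ = contradiction p ¬p₀
least P? (suc m) p | no ¬p₀ with least (P? ∘ suc) m p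
... | k , pₖ , min = suc k , pₖ , λ
  { zero    p₀ → contradiction p₀ ¬p₀
  ; (suc j) pⱼ → s≤s (min j pⱼ) }

module _ (G : ConnectedGraph) where

  private V = Fin (order G)

  -- A walk of minimum length is a path, so walks suffice.
  shortest : (u v : V) → ∃[ k ] (Walk (graph G) k u v × (∀ j → Walk (graph G) j u v → k ≤ⁿ j))
  shortest u v = let m , p = connected G u v in least (λ k → walk? (graph G) k u v) m p

  dist : V → V → ℕ
  dist u v = proj₁ (shortest u v)

  dist-walk : ∀ u v → Walk (graph G) (dist u v) u v
  dist-walk u v = proj₁ (proj₂ (shortest u v))

  dist-min : ∀ u v j → Walk (graph G) j u v → dist u v ≤ⁿ j
  dist-min u v = proj₂ (proj₂ (shortest u v))

  dist-sym : ∀ u v → dist u v ≡ dist v u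
  dist-sym u v = ℕ.≤-antisym
    (dist-min u v _ (reverse (graph G) _ (dist-walk v u)))
    (dist-min v u _ (reverse (graph G) _ (dist-walk u v)))

  dist-pos : ∀ {u v} → u ≢ v → 0 <ⁿ dist u v
  dist-pos {u} {v} u≢v = ℕ.n≢0⇒n>0 λ d≡0 →
    u≢v (subst (λ k → Walk (graph G) k u v) d≡0 (dist-walk u v))

power : (G : ConnectedGraph) (k : ℕ) .{{_ : NonZero k}} → ConnectedGraph
power G k = ⟨ Gᵏ , (λ u v → let m , p = connected G u v in
                      m , mapWalk (graph G) Gᵏ (λ x → x) adj m p) ⟩
  where
  Gᵏ : Graph (order G)
  Gᵏ = record
    { Adj    = λ u v → u ≢ v × dist G u v ≤ⁿ k
    ; adj?   = λ u v → ¬? (u Fin.≟ v) ×-dec (dist G u v ℕ.≤? k)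
    ; symm   = λ {u} {v} (u≢v , d≤k) → u≢v ∘ sym , subst (_≤ⁿ k) (dist-sym G u v) d≤k
    ; irrefl = λ (u≢u , _) → u≢u refl
    }
  adj : ∀ {u v} → Adj (graph G) u v → Adj Gᵏ u v
  adj {u} {v} a = (λ { refl → irrefl (graph G) a })
                , ℕ.≤-trans (dist-min G u v 1 (v , a , refl)) (>-nonZero⁻¹ k)

pathGraph : ∀ n → Graph n
pathGraph n = record
  { Adj    = λ i j → ∣ toℕ i - toℕ j ∣ ≡ 1
  ; adj?   = λ i j → ∣ toℕ i - toℕ j ∣ ℕ.≟ 1
  ; symm   = λ {i} {j} p → trans (ℕ.∣-∣-comm (toℕ j) (toℕ i)) p
  ; irrefl = λ {i} p → contradiction (trans (sym (ℕ.∣n-n∣≡0 (toℕ i))) p) λ ()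
  }

pathGraph-connected : ∀ n → Connected (pathGraph n)
pathGraph-connected (suc n) zero zero = 0 , refl
pathGraph-connected (suc (suc n)) zero (suc v) =
  let k , p = pathGraph-connected (suc n) zero v
  in suc k , suc zero , refl , mapWalk (pathGraph _) (pathGraph _) suc (λ a → a) k p
pathGraph-connected (suc (suc n)) (suc u) zero =
  let k , p = pathGraph-connected (suc n) u zero
  in suc k , snoc (pathGraph _) k (mapWalk (pathGraph _) (pathGraph _) suc (λ a → a) k p) refl
pathGraph-connected (suc n) (suc u) (suc v) =
  let k , p = pathGraph-connected n u v
  in k , mapWalk (pathGraph n) (pathGraph (suc n)) suc (λ a → a) k p

P : ℕ → ConnectedGraph
P n = ⟨ pathGraph n , pathGraph-connected n ⟩

ℕ⁺ : Set
ℕ⁺ = [ n ∈ ℕ ∣ 0 <ⁿ n ]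

ℕ⁺-≤-decTotalOrder : DecTotalOrder _ _ _
ℕ⁺-≤-decTotalOrder = On.decTotalOrder ℕ.≤-decTotalOrder (value {P = 0 <ⁿ_})

-- Each unordered pair of distinct vertices is listed once, smaller label first.
distinctPairs : ∀ n → List (∃[ u ] Σ[ v ∈ Fin n ] u Fin.< v)
distinctPairs n = mapMaybe
  (λ (u , v) → Maybe.map (λ u<v → u , v , u<v) (dec⇒maybe (u Fin.<? v)))
  (cartesianProduct (allFin n) (allFin n))

distanceSequence : ConnectedGraph → List ℕ⁺
distanceSequence G = Sort.sort ℕ⁺-≤-decTotalOrder
  (map (λ (u , v , u<v) → dist G u v , [ dist-pos G (Fin.<⇒≢ u<v) ])
       (distinctPairs (order G)))

TopologicalIndex : Set₁
TopologicalIndex = ConnectedGraph → ℝ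

Expresses : (List ℕ⁺ → ℝ) → TopologicalIndex → Set₁
Expresses g I = ∀ G → I G ≈ g (distanceSequence G)

Nondecreasing Nonincreasing : (List ℕ⁺ → ℝ) → Set
Nondecreasing g = ∀ xs {a b} ys → value a ≤ⁿ value b → g (xs ++ a ∷ ys) ≤ g (xs ++ b ∷ ys)
Nonincreasing g = ∀ xs {a b} ys → value a ≤ⁿ value b → g (xs ++ a ∷ ys) ≥ g (xs ++ b ∷ ys)

NondecreasingDistanceBased NonincreasingDistanceBased : TopologicalIndex → Set₁
NondecreasingDistanceBased I = ∃[ g ] (Expresses g I × Nondecreasing g)
NonincreasingDistanceBased I = ∃[ g ] (Expresses g I × Nonincreasing g)

module _ {V : Set} where

  IsEdge : List (V × V) → V → V → Set
  IsEdge es u v = (u , v) ∈ es ⊎ (v , u) ∈ es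

  Drawable : List (V × V) → V → V → Set
  Drawable es u v = u ≢ v × ¬ IsEdge es u v

data Side : Set where
  outer inner : Side

-- A face is given by its boundary walks, one for each component of the
-- boundary, traced with the face always on the same hand.  A boundary walk
-- lists the vertices met, the starting vertex being repeated at the end:
-- u ∷ … ∷ u ∷ [], or u ∷ [] when the component is the isolated vertex u.
-- Every occurrence of u in such a walk (the two ends counting as one) is one
-- of the angles at u through which an edge can leave u into the face.
Face : Set → Set
Face V = Side × List (List V)

-- Combinatorial plane embeddings, for graphs that need not be connected: the
-- vertices and edges are drawn one at a time, each within a face of what has
-- been drawn so far, so that edges never meet except at common ends.  Every
-- plane graph arises in this way, as subgraphs of plane graphs are plane.
data Drawing {V : Set} : List V → List (V × V) → List (Face V) → Set where

  blank : Drawing [] [] ((outer , []) ∷ [])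

  vertex : ∀ {vs es s f fs v} → v ∉ vs →
    Drawing vs es ((s , f) ∷ fs) →
    Drawing (v ∷ vs) es ((s , (v ∷ []) ∷ f) ∷ fs)

  -- An edge between two components of the boundary of a face merges these.
  join : ∀ {vs es s f fs u v xs ys} → Drawable es u v →
    Drawing vs es ((s , (u ∷ xs) ∷ (v ∷ ys) ∷ f) ∷ fs) →
    Drawing vs ((u , v) ∷ es) ((s , ((u ∷ xs) ++ (v ∷ ys) ++ u ∷ []) ∷ f) ∷ fs)

  -- An edge within one component of the boundary divides the face in two, the
  -- other components lying on either side of it.  One part of the outer face
  -- is bounded; as u and v are interchangeable up to rotation of the walk, it
  -- can be either part.
  split : ∀ {vs es s f g fs u v xs ys} → Drawable es u v →
    Drawing vs es ((s , (u ∷ xs ++ v ∷ ys) ∷ f ++ g) ∷ fs) →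
    Drawing vs ((u , v) ∷ es)
      ((s , (u ∷ xs ++ v ∷ u ∷ []) ∷ f) ∷ (inner , (v ∷ ys ++ v ∷ []) ∷ g) ∷ fs)

  rotate : ∀ {vs es s f fs u v xs} →
    Drawing vs es ((s , (u ∷ v ∷ xs) ∷ f) ∷ fs) →
    Drawing vs es ((s , (v ∷ xs ++ v ∷ []) ∷ f) ∷ fs)

  reorderWalks : ∀ {vs es s f f′ fs} → f ↭ f′ →
    Drawing vs es ((s , f) ∷ fs) → Drawing vs es ((s , f′) ∷ fs)

  reorderFaces : ∀ {vs es fs fs′} → fs ↭ fs′ →
    Drawing vs es fs → Drawing vs es fs′

Depicts : ∀ {n} → List (Fin n) → List (Fin n × Fin n) → Graph n → Set
Depicts vs es G = (∀ v → v ∈ vs) × (∀ u v → Adj G u v ⇔ IsEdge es u v)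

Outerplanar : ∀ {n} → Graph n → Set
Outerplanar {n} G =
  ∃[ vs ] ∃[ es ] ∃[ fs ] (Drawing {Fin n} vs es fs × Depicts vs es G ×
    ∃[ f ] ((outer , f) ∈ fs × (∀ v → ∃[ w ] (w ∈ f × v ∈ w))))

MaximalOuterplanar : ∀ {n} → Graph n → Set
MaximalOuterplanar G = Outerplanar G ×
  (∀ u v (u≢v : u ≢ v) → ¬ Adj G u v → ¬ Outerplanar (addEdge G u v u≢v))

-- The faces are the triangles (a , b , c); initially, these are the two sides
-- of a single triangle.
data Stacking {V : Set} : List V → List (V × V) → List (V × V × V) → Set where

  triangle : ∀ {a b c} → a ≢ b → b ≢ c → c ≢ a →
    Stacking (a ∷ b ∷ c ∷ []) ((a , b) ∷ (b , c) ∷ (c , a) ∷ [])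
             ((a , b , c) ∷ (a , c , b) ∷ [])

  insert : ∀ {vs es fs fs′ a b c v} → v ∉ vs → fs ↭ (a , b , c) ∷ fs′ →
    Stacking vs es fs →
    Stacking (v ∷ vs) ((v , a) ∷ (v , b) ∷ (v , c) ∷ es)
             ((a , b , v) ∷ (b , c , v) ∷ (c , a , v) ∷ fs′)

ApollonianNetwork : ∀ {n} → Graph n → Set
ApollonianNetwork {n} G =
  ∃[ vs ] ∃[ es ] ∃[ fs ] (Stacking {Fin n} vs es fs × Depicts vs es G)

{-# OPTIONS --safe #-}
module Submission where

import Algebra.Solver.CommutativeMonoid as CommutativeMonoidSolver
open import Data.Empty using (⊥)
open import Data.Fin.Base as Fin using (Fin; zero; suc; toℕ)
import Data.Fin.Properties as Fin
open import Data.List.Base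
  using (List; []; _∷_; _++_; length; map; mapMaybe; concatMap; filter; cartesianProduct; allFin;
         tabulate)
open import Data.List.Properties
import Data.List.Membership.DecPropositional as DecMembership
open import Data.List.Membership.Propositional using (_∈_; _∉_; find; lose)
open import Data.List.Membership.Propositional.Properties
  using (∈-filter⁺; ∈-filter⁻; ∈-∃++; ∈-map⁺; ∈-allFin; ∈-++⁺ˡ; ∈-++⁺ʳ; ∈-++⁻; ∈-concatMap⁺)
open import Data.List.Membership.Propositional.Properties.WithK using (unique∧set⇒bag)
open import Data.List.Relation.Binary.BagAndSetEquality using (∼bag⇒↭)
open import Data.List.Relation.Binary.Disjoint.Propositional using (Disjoint)
import Data.List.Relation.Binary.Disjoint.Propositional.Properties as Disjoint
open import Data.List.Relation.Binary.Permutation.Propositional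
  using (_↭_; prep; swap; ↭-refl; ↭-sym; ↭-trans; ↭-reflexive; ↭⇒↭ₛ; module PermutationReasoning)
open import Data.List.Relation.Binary.Permutation.Propositional.Properties hiding (++-assoc; ++-identityʳ)
import Data.List.Relation.Binary.Permutation.Setoid.Properties as ↭ₛ
open import Data.List.Relation.Binary.Pointwise.Base using (Pointwise; []; _∷_)
open import Data.List.Relation.Binary.Subset.Propositional using (_⊆_)
open import Data.List.Relation.Unary.All as All using (All; []; _∷_)
import Data.List.Relation.Unary.All.Properties as All
open import Data.List.Relation.Unary.All.Properties using (¬Any⇒All¬)
open import Data.List.Relation.Unary.AllPairs using (AllPairs; []; _∷_)
import Data.List.Relation.Unary.AllPairs.Properties as AllPairs
open import Data.List.Relation.Unary.Any as Any using (Any; here; there; any?)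
open import Data.List.Relation.Unary.Sorted.TotalOrder.Properties using (Sorted⇒AllPairs)
open import Data.List.Relation.Unary.Unique.Propositional using (Unique)
import Data.List.Relation.Unary.Unique.Propositional.Properties as Unique
import Data.List.Sort as Sort
open import Data.Maybe.Base as Maybe using (Maybe)
open import Data.Nat.Base renaming (_≤_ to _≤ⁿ_; _≥_ to _≥ⁿ_)
open import Data.Nat.Properties
open import Data.Product.Base as Product using (∃-syntax; Σ-syntax; _×_; _,_; proj₁; proj₂)
open import Data.Refinement.Base using (value)
open import Data.Sum.Base as Sum using (_⊎_; inj₁; inj₂)
open import Function.Base using (_∘_; id; _$_; case_of_)
open import Function.Bundles using (mk⇔; Equivalence)
open import Relation.Binary.Bundles using (DecTotalOrder)
open import Relation.Binary.Definitions using (Reflexive; Transitive)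
open import Relation.Binary.PropositionalEquality
open import Relation.Nullary.Decidable using (yes; no; ¬?; _×-dec_; dec⇒maybe; decidable-stable)
open import Relation.Nullary.Negation using (¬_; contradiction)
open import Relation.Unary using (Decidable)
open import Defs

-- Suppose that a graph is built up by adding vertices one at a time, each joined to at least
-- min(k, m) of the m vertices already present.  Then every set of vertices separating two others
-- has at least k elements, so all levels around a vertex v but the last have at least k vertices,
-- and the ball of radius d around v contains at least min(m, dk) of the m other vertices.  Counting
-- for each added vertex the earlier ones in its ball, at least as many pairs are at distance at
-- most d as in Pₙᵏ, for every d; so the sorted distance sequences compare entrywise.
--
-- Apollonian networks are of this kind for k = 3 by construction.  For a maximal outerplanar graph let C be the
-- closure of an edge of the outer face under adding vertices with two neighbours in C.  Maximality
-- makes all inner faces cliques, so C is left and entered only along the outer face; if this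
-- happens at a vertex u, then u occurs twice on the outer face, and its two neighbours at one of
-- these occurrences can be joined, contradicting maximality.  Hence C contains all vertices.

private variable
  A B V : Set
  n : ℕ
  u v z : V
  vs xs ys : List V
  es : List (V × V)

count : {Q : A → Set} → Decidable Q → List A → ℕ
count Q? xs = length (filter Q? xs)

count-++ : {Q : A → Set} (Q? : Decidable Q) (xs ys : List A) →
           count Q? (xs ++ ys) ≡ count Q? xs + count Q? ys
count-++ Q? xs ys = trans (cong length (filter-++ Q? xs ys)) (length-++ (filter Q? xs))

count-↭ : {Q : A → Set} (Q? : Decidable Q) {xs ys : List A} → xs ↭ ys → count Q? xs ≡ count Q? ys
count-↭ Q? = ↭-length ∘ filter-↭ Q?

count-map : {Q : B → Set} (Q? : Decidable Q) (f : A → B) (xs : List A) →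
            count Q? (map f xs) ≡ count (Q? ∘ f) xs
count-map Q? f []       = refl
count-map Q? f (x ∷ xs) with Q? (f x)
... | yes _ = cong suc (count-map Q? f xs)
... | no  _ = count-map Q? f xs

count-all : {Q : A → Set} (Q? : Decidable Q) {xs : List A} → All Q xs → count Q? xs ≡ length xs
count-all Q? = cong length ∘ filter-all Q?

count-mono : {Q R : A → Set} (Q? : Decidable Q) (R? : Decidable R) {xs : List A} →
             All (λ x → Q x → R x) xs → count Q? xs ≤ⁿ count R? xs
count-mono Q? R? []                      = z≤n
count-mono Q? R? {x ∷ xs} (q⇒r ∷ q⇒rs) with Q? x | R? x
... | yes q | no ¬r = contradiction (q⇒r q) ¬r
... | yes _ | yes _ = s≤s (count-mono Q? R? q⇒rs)
... | no  _ | yes _ = m≤n⇒m≤1+n (count-mono Q? R? q⇒rs)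
... | no  _ | no  _ = count-mono Q? R? q⇒rs

count-∷ : {Q : A → Set} (Q? : Decidable Q) (x : A) (xs : List A) → count Q? xs ≤ⁿ count Q? (x ∷ xs)
count-∷ Q? x xs with Q? x
... | yes _ = n≤1+n _
... | no  _ = ≤-refl

count-disjoint : {Q R S : A → Set} (Q? : Decidable Q) (R? : Decidable R) (S? : Decidable S) →
  (∀ {x} → Q x → S x) → (∀ {x} → R x → S x) → (∀ {x} → Q x → ¬ R x) →
  ∀ xs → count Q? xs + count R? xs ≤ⁿ count S? xs
count-disjoint Q? R? S? q⇒s r⇒s q⇒¬r []       = z≤n
count-disjoint Q? R? S? q⇒s r⇒s q⇒¬r (x ∷ xs)
  with ih ← count-disjoint Q? R? S? q⇒s r⇒s q⇒¬r xs | Q? x | R? x | S? x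
... | yes q | yes r | _     = contradiction r (q⇒¬r q)
... | yes q | _     | no ¬s = contradiction (q⇒s q) ¬s
... | _     | yes r | no ¬s = contradiction (r⇒s r) ¬s
... | yes _ | no  _ | yes _ = s≤s ih
... | no  _ | yes _ | yes _ = ≤-trans (≤-reflexive (+-suc _ _)) (s≤s ih)
... | no  _ | no  _ | yes _ = m≤n⇒m≤1+n ih
... | no  _ | no  _ | no  _ = ih

unique-length-≤ : {xs ys : List A} → Unique xs → (∀ {x} → x ∈ xs → x ∈ ys) → length xs ≤ⁿ length ys
unique-length-≤ []                      _   = z≤n
unique-length-≤ {xs = x ∷ xs} (x∉xs ∷ u) sub with ps , qs , refl ← ∈-∃++ (sub (here refl)) =
  ≤-trans (s≤s (unique-length-≤ u sub′)) (≤-reflexive (sym (↭-length (shift x ps qs))))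
  where
  sub′ : ∀ {y} → y ∈ xs → y ∈ ps ++ qs
  sub′ y∈xs with ∈-resp-↭ (shift x ps qs) (sub (there y∈xs))
  ... | here refl = contradiction refl (All.lookup x∉xs y∈xs)
  ... | there y∈  = y∈

count-unique : {Q : A → Set} (Q? : Decidable Q) {xs ys : List A} → Unique xs →
               All (λ x → x ∈ ys × Q x) xs → length xs ≤ⁿ count Q? ys
count-unique Q? u all = unique-length-≤ u λ x∈xs →
  let x∈ys , q = All.lookup all x∈xs in ∈-filter⁺ Q? x∈ys q

-- Unordered pairs

pairs : (A → A → B) → List A → List B
pairs f []       = []
pairs f (x ∷ xs) = map (f x) xs ++ pairs f xs

-- A swap of neighbouring entries turns `f x y` into `f y x`, hence the symmetry hypothesis. This
-- lets vertices in order of construction stand in for vertices in order of labels.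
pairs-↭ : (f : A → A → B) → (∀ x y → f x y ≡ f y x) →
          {xs ys : List A} → xs ↭ ys → pairs f xs ↭ pairs f ys
pairs-↭ f f-sym _↭_.refl = ↭-refl
pairs-↭ f f-sym (prep x p) = ++⁺ (map⁺ (f x) p) (pairs-↭ f f-sym p)
pairs-↭ f f-sym {_ ∷ _ ∷ xs} {_ ∷ _ ∷ ys} (swap x y p) rewrite f-sym x y = prep (f y x) (begin
  map (f x) xs ++ map (f y) xs ++ pairs f xs ↭⟨ shifts (map (f x) xs) (map (f y) xs) ⟩
  map (f y) xs ++ map (f x) xs ++ pairs f xs
    ↭⟨ ++⁺ (map⁺ (f y) p) (++⁺ (map⁺ (f x) p) (pairs-↭ f f-sym p)) ⟩
  map (f y) ys ++ map (f x) ys ++ pairs f ys ∎)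
  where open PermutationReasoning
pairs-↭ f f-sym (_↭_.trans p q) = ↭-trans (pairs-↭ f f-sym p) (pairs-↭ f f-sym q)

length-pairs : (f : A → A → B) (xs : List A) (g : A → A → B) → length (pairs f xs) ≡ length (pairs g xs)
length-pairs f []       g = refl
length-pairs f (x ∷ xs) g = begin
  length (map (f x) xs ++ pairs f xs)          ≡⟨ length-++ (map (f x) xs) ⟩
  length (map (f x) xs) + length (pairs f xs)
    ≡⟨ cong₂ _+_ (trans (length-map (f x) xs) (sym (length-map (g x) xs))) (length-pairs f xs g) ⟩
  length (map (g x) xs) + length (pairs g xs)  ≡⟨ length-++ (map (g x) xs) ⟨
  length (map (g x) xs ++ pairs g xs)          ∎
  where open ≡-Reasoning

-- The number of pairs u < v of numbers below n with v ∸ u ≤ m.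
bandSize : ℕ → ℕ → ℕ
bandSize m zero    = 0
bandSize m (suc n) = n ⊓ m + bandSize m n

count-pairs-∷ : {Q : B → Set} (Q? : Decidable Q) (f : A → A → B) (x : A) (xs : List A) →
                count Q? (pairs f (x ∷ xs)) ≡ count (Q? ∘ f x) xs + count Q? (pairs f xs)
count-pairs-∷ Q? f x xs =
  trans (count-++ Q? (map (f x) xs) _) (cong (_+ _) (count-map Q? (f x) xs))

-- Graphs built up vertex by vertex

module _ {n} (G : Graph n) where
  open Graph G

  -- The newest vertex heads the list. The minimum lets the construction start from nothing: while
  -- at most `k` vertices are present, the new one is joined to all of them.
  data Accretion (k : ℕ) : List (Fin n) → Set where
    []  : Accretion k []
    add : ∀ {v vs} → v ∉ vs → k ⊓ length vs ≤ⁿ count (adj? v) vs →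
          Accretion k vs → Accretion k (v ∷ vs)

  accretion-unique : ∀ {k vs} → Accretion k vs → Unique vs
  accretion-unique []             = []
  accretion-unique (add v∉vs _ a) = ¬Any⇒All¬ _ v∉vs ∷ accretion-unique a

  private
    -- The non-neighbour `z` makes the degree of `v` into `vs` smaller than `length vs`, so the
    -- degree bound can only be met through `k`; and all these neighbours satisfy `Q`.
    all-neighbours-in : ∀ {k v z vs} {Q : Fin n → Set} (Q? : Decidable Q) →
      k ⊓ length vs ≤ⁿ count (adj? v) vs → All (λ w → Adj v w → Q w) vs →
      z ∈ vs → ¬ Adj v z → k ≤ⁿ count Q? vs
    all-neighbours-in {k} {v} {z} {vs} Q? deg all z∈vs ¬vz =
      ≤-trans (≮⇒≥ λ few → <-irrefl refl (<-≤-trans (⊓-pres-m< few notAll) deg))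
              (count-mono (adj? v) Q? all)
      where
      notAll : count (adj? v) vs < length vs
      notAll = filter-notAll (adj? v) vs (Any.map (λ { refl → ¬vz }) z∈vs)

  module _ (δ : Fin n → ℕ) (lipschitz : ∀ {u v} → Adj u v → δ v ≤ⁿ suc (δ u)) where

    -- The vertices of one level separate those below from those above.
    level-size : ∀ {k vs} d → Accretion k vs →
      Any (λ x → δ x ≤ⁿ d) vs → Any (λ y → δ y > suc d) vs → k ≤ⁿ count (λ v → δ v ≟ suc d) vs
    level-size d (add _ _ a) (there x) (there y) = ≤-trans (level-size d a x y) (count-∷ (λ v → δ v ≟ suc d) _ _)
    level-size d (add _ _ a) (here x≤) (here y>) = contradiction (<-≤-trans y> (m≤n⇒m≤1+n x≤)) (<-irrefl refl)
    level-size d (add {v} {vs} _ deg a) (here x≤) (there far) with any? (λ x → δ x ≤? d) vs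
    ... | yes near = ≤-trans (level-size d a near far) (count-∷ (λ v → δ v ≟ suc d) _ _)
    -- Now `v` is the only vertex of level at most `d`, so its neighbours all have level exactly
    -- `suc d`, and the far vertex is not one of them. The next clause is the mirror image.
    ... | no ¬near = ≤-trans (all-neighbours-in (λ v → δ v ≟ suc d) deg
            (All.map (λ ≰d vw → ≤-antisym (≤-trans (lipschitz vw) (s≤s x≤)) (≰⇒> ≰d)) (¬Any⇒All¬ vs ¬near))
            (proj₁ (proj₂ (find far))) λ vz →
              contradiction (proj₂ (proj₂ (find far))) (≤⇒≯ (≤-trans (lipschitz vz) (s≤s x≤))))
            (count-∷ (λ v → δ v ≟ suc d) _ _)
    level-size d (add {v} {vs} _ deg a) (there near) (here y>) with any? (λ y → suc d <? δ y) vs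
    ... | yes far = ≤-trans (level-size d a near far) (count-∷ (λ v → δ v ≟ suc d) _ _)
    ... | no ¬far = ≤-trans (all-neighbours-in (λ v → δ v ≟ suc d) deg
            (All.map (λ ≯d vw → ≤-antisym (≮⇒≥ ≯d) (s≤s⁻¹ (<-≤-trans y> (lipschitz (symm vw))))) (¬Any⇒All¬ vs ¬far))
            (proj₁ (proj₂ (find near))) λ vz →
              contradiction (<-≤-trans y> (lipschitz (symm vz))) (≤⇒≯ (s≤s (proj₂ (proj₂ (find near))))))
            (count-∷ (λ v → δ v ≟ suc d) _ _)

    -- Induction on `d`: either the ball of radius `suc d` is all of `vs`, or some vertex lies
    -- beyond it and the level `suc d` contributes `k` more. The extra one in the bound is the
    -- centre.
    ball-size : ∀ {k vs v} d → Accretion k vs → v ∈ vs → δ v ≡ 0 →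
                length vs ⊓ suc (d * k) ≤ⁿ count (λ v → δ v ≤? d) vs
    ball-size {vs = vs} zero a v∈vs δ≡0 =
      ≤-trans (m⊓n≤n (length vs) 1) (filter-some (λ v → δ v ≤? 0) (Any.map (λ { refl → ≤-reflexive δ≡0 }) v∈vs))
    ball-size {k} {vs} (suc d) a v∈vs δ≡0 with any? (λ y → suc d <? δ y) vs
    ... | no ¬far = ≤-trans (m⊓n≤m (length vs) _)
      (≤-reflexive (sym (count-all (λ v → δ v ≤? suc d) (All.map ≮⇒≥ (¬Any⇒All¬ vs ¬far)))))
    ... | yes far = begin
      length vs ⊓ suc (k + d * k)
        ≡⟨ cong (λ m → length vs ⊓ suc m) (+-comm k (d * k)) ⟩
      length vs ⊓ (suc (d * k) + k)
        -- The slack `k` added to `length vs` lets addition distribute over the minimum.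
        ≤⟨ ⊓-monoˡ-≤ _ (m≤m+n (length vs) k) ⟩
      (length vs + k) ⊓ (suc (d * k) + k)
        ≡⟨ +-distribʳ-⊓ k (length vs) (suc (d * k)) ⟨
      (length vs ⊓ suc (d * k)) + k
        ≤⟨ +-mono-≤ (ball-size d a v∈vs δ≡0)
          (level-size d a (Any.map (λ { refl → ≤-trans (≤-reflexive δ≡0) z≤n }) v∈vs) far) ⟩
      count (λ v → δ v ≤? d) vs + count (λ v → δ v ≟ suc d) vs
        ≤⟨ count-disjoint (λ v → δ v ≤? d) (λ v → δ v ≟ suc d) (λ v → δ v ≤? suc d)
          m≤n⇒m≤1+n ≤-reflexive (λ ≤d ≡1+d → <-irrefl refl (≤-trans (≤-reflexive (sym ≡1+d)) ≤d)) vs ⟩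
      count (λ v → δ v ≤? suc d) vs                                        ∎
      where open ≤-Reasoning

  -- The newest vertex contributes its ball among the earlier ones, matching the recursion of
  -- `bandSize`. Here `δ` can be the distance in the whole graph although only a part has been
  -- built, since `level-size` rests on the Lipschitz property and not on shortest walks inside that
  -- part.
  pairs-bound : (δ : Fin n → Fin n → ℕ) → (∀ v → δ v v ≡ 0) →
    (∀ {u v w} → Adj v w → δ u w ≤ⁿ suc (δ u v)) →
    ∀ {k vs} d → Accretion k vs → bandSize (d * k) (length vs) ≤ⁿ count (_≤? d) (pairs δ vs)
  pairs-bound δ δ-refl lipschitz d []            = z≤n
  pairs-bound δ δ-refl lipschitz {k} {v ∷ vs} d a@(add _ _ a′) = begin
    length vs ⊓ (d * k) + bandSize (d * k) (length vs)
      ≤⟨ +-mono-≤ row (pairs-bound δ δ-refl lipschitz d a′) ⟩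
    count (λ w → δ v w ≤? d) vs + count (_≤? d) (pairs δ vs)               ≡⟨ count-pairs-∷ (_≤? d) δ v vs ⟨
    count (_≤? d) (pairs δ (v ∷ vs))                                       ∎
    where
    open ≤-Reasoning
    row : length vs ⊓ (d * k) ≤ⁿ count (λ w → δ v w ≤? d) vs
    -- The ball bound also counts the centre `v`; both sides lose one.
    row = s≤s⁻¹ (≤-trans (ball-size (δ v) lipschitz d a (here refl) (δ-refl v))
      (≤-reflexive (cong length (filter-accept (λ w → δ v w ≤? d) (≤-trans (≤-reflexive (δ-refl v)) z≤n)))))

  accretion-connected : ∀ {k vs} → Accretion (suc k) vs → ∀ {u v} → u ∈ vs → v ∈ vs → ∃[ j ] Walk G j u v

  private
    walk-from-new : ∀ {k u vs} → suc k ⊓ length vs ≤ⁿ count (adj? u) vs → Accretion (suc k) vs →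
                  ∀ {v} → v ∈ vs → ∃[ j ] Walk G j u v
    walk-from-new {u = u} {vs@(_ ∷ _)} deg a v∈ with filter (adj? u) vs in eq | deg
    -- Since `vs` is nonempty, the degree bound is a successor, which rules out an empty list of
    -- neighbours.
    ... | x ∷ _ | _ =
      let x∈vs , ux = ∈-filter⁻ (adj? u) {xs = vs} (subst (x ∈_) (sym eq) (here refl))
          j , p = accretion-connected a x∈vs v∈
      in suc j , x , ux , p

  accretion-connected (add _ _ a)   (there u∈)  (there v∈)  = accretion-connected a u∈ v∈
  accretion-connected (add _ _ a)   (here refl) (here refl) = 0 , refl
  accretion-connected (add _ deg a) (here refl) (there v∈)  = walk-from-new deg a v∈
  accretion-connected (add _ deg a) (there u∈)  (here refl) =
    let j , p = walk-from-new deg a u∈ in j , reverse G j p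

-- Distance sequences as lists over unordered pairs

accretion-↭-allFin : ∀ {G : Graph n} {k vs} → Accretion G k vs → (∀ v → v ∈ vs) → vs ↭ allFin n
accretion-↭-allFin {n} {G} a all = ∼bag⇒↭ $
  unique∧set⇒bag (accretion-unique G a) (Unique.allFin⁺ n) (mk⇔ (λ _ → ∈-allFin _) (λ _ → all _))

-- Labels increase along `allFin n`, so in each row the test `u < v` rejects everything up to the
-- diagonal and keeps the rest; the two enumerations agree even in order.
map-distinctPairs : (f : Fin n → Fin n → A) →
                    map (λ (u , v , _) → f u v) (distinctPairs n) ≡ pairs f (allFin n)
map-distinctPairs {n} {A} f = trans (map-mapMaybe _ _ (cartesianProduct (allFin n) (allFin n)))
                                   (ordered (allFin n) (AllPairs.tabulate⁺-< id))
  where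
  open ≡-Reasoning
  apply : ∃[ u ] Σ[ v ∈ Fin n ] u Fin.< v → A
  apply (u , v , _) = f u v

  select : Fin n × Fin n → Maybe A
  select (u , v) = Maybe.map apply (Maybe.map (λ u<v → u , v , u<v) (dec⇒maybe (u Fin.<? v)))

  row : ∀ u ys → List A
  row u ys = mapMaybe select (map (u ,_) ys)

  row-≮ : ∀ {u x} ys → ¬ u Fin.< x → row u (x ∷ ys) ≡ row u ys
  row-≮ {u} {x} ys u≮x with u Fin.<? x
  ... | yes u<x = contradiction u<x u≮x
  ... | no  _   = refl

  row-< : ∀ {u ys} → All (u Fin.<_) ys → row u ys ≡ map (f u) ys
  row-< []                    = refl
  row-< {u} {x ∷ _} (u<x ∷ u<) with u Fin.<? x
  ... | yes _   = cong (_ ∷_) (row-< u<)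
  ... | no  u≮x = contradiction u<x u≮x

  rows : ∀ xs ys → List A
  rows xs ys = mapMaybe select (cartesianProduct xs ys)

  rows-∷ : ∀ x xs ys → rows (x ∷ xs) ys ≡ row x ys ++ rows xs ys
  rows-∷ x xs ys = mapMaybe-++ select (map (x ,_) ys) (cartesianProduct xs ys)

  drop-column : ∀ {x xs} ys → All (x Fin.<_) xs → rows xs (x ∷ ys) ≡ rows xs ys
  drop-column ys [] = refl
  drop-column {x} {u ∷ xs} ys (x<u ∷ x<) = begin
    rows (u ∷ xs) (x ∷ ys)            ≡⟨ rows-∷ u xs (x ∷ ys) ⟩
    row u (x ∷ ys) ++ rows xs (x ∷ ys) ≡⟨ cong₂ _++_ (row-≮ ys (<⇒≯ x<u)) (drop-column ys x<) ⟩
    row u ys ++ rows xs ys            ≡⟨ rows-∷ u xs ys ⟨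
    rows (u ∷ xs) ys                  ∎

  ordered : ∀ xs → AllPairs Fin._<_ xs → rows xs xs ≡ pairs f xs
  ordered []       []        = refl
  ordered (x ∷ xs) (x< ∷ xs<) = begin
    rows (x ∷ xs) (x ∷ xs)              ≡⟨ rows-∷ x xs (x ∷ xs) ⟩
    row x (x ∷ xs) ++ rows xs (x ∷ xs)
      ≡⟨ cong₂ _++_ (trans (row-≮ xs (<-irrefl refl)) (row-< x<))
                    (trans (drop-column xs x<) (ordered xs xs<)) ⟩
    map (f x) xs ++ pairs f xs          ∎

distances-↭ : ∀ G → map value (distanceSequence G) ↭ pairs (dist G) (allFin (ConnectedGraph.order G))
distances-↭ G = begin
  map value (distanceSequence G)   ↭⟨ map⁺ value (Sort.sort-↭ ℕ⁺-≤-decTotalOrder _) ⟩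
  map value (map _ (distinctPairs _)) ≡⟨ map-∘ (distinctPairs _) ⟨
  map _ (distinctPairs _)          ≡⟨ map-distinctPairs (dist G) ⟩
  pairs (dist G) (allFin _)        ∎
  where open PermutationReasoning

count-distances : ∀ G d → count (λ a → value a ≤? d) (distanceSequence G) ≡ count (_≤? d) (pairs (dist G) (allFin _))
count-distances G d = trans (sym (count-map (_≤? d) value (distanceSequence G))) (count-↭ (_≤? d) (distances-↭ G))

-- Entrywise comparison of sorted sequences

_≼_ : ℕ⁺ → ℕ⁺ → Set
a ≼ b = value a ≤ⁿ value b

sorted-dominated : ∀ {xs ys : List ℕ⁺} → AllPairs _≼_ xs → AllPairs _≼_ ys → length xs ≡ length ys →
  (∀ d → count (λ a → value a ≤? d) ys ≤ⁿ count (λ a → value a ≤? d) xs) → Pointwise _≼_ xs ys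
sorted-dominated []        []        _  _ = []
sorted-dominated {x ∷ xs} {y ∷ ys} (x≼ ∷ xs≼) (y≼ ∷ ys≼) eq counts =
  x≼y ∷ sorted-dominated xs≼ ys≼ (suc-injective eq) tails
  where
  below : ∀ d → Decidable (λ a → value a ≤ⁿ d)
  below d a = value a ≤? d

  x≼y : x ≼ y
  x≼y = ≮⇒≥ λ y<x → contradiction (begin-strict
    0                         <⟨ filter-some (below (value y)) {y ∷ ys} (here ≤-refl) ⟩
    count (below (value y)) (y ∷ ys) ≤⟨ counts (value y) ⟩
    count (below (value y)) (x ∷ xs)
      ≡⟨ cong length (filter-none (below (value y)) (<⇒≱ y<x ∷ All.map (λ x≤ → <⇒≱ (<-≤-trans y<x x≤)) x≼)) ⟩
    0                         ∎) (<-irrefl refl)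
    where open ≤-Reasoning

  tails : ∀ d → count (below d) ys ≤ⁿ count (below d) xs
  tails d with value y ≤? d
  ... | yes y≤d = s≤s⁻¹ (begin
    suc (count (below d) ys)  ≡⟨ cong length (filter-accept (below d) y≤d) ⟨
    count (below d) (y ∷ ys)  ≤⟨ counts d ⟩
    count (below d) (x ∷ xs)  ≡⟨ cong length (filter-accept (below d) (≤-trans x≼y y≤d)) ⟩
    suc (count (below d) xs)  ∎)
    where open ≤-Reasoning
  ... | no y≰d = ≤-trans (≤-reflexive (cong length (filter-none (below d) (All.map (λ y≤ → y≰d ∘ ≤-trans y≤) y≼)))) z≤n

-- Entries are replaced one at a time from the left, `ws` collecting those already replaced. The
-- relation is a parameter so that both kinds of monotonicity are covered.
pointwise-chain : (_⊑_ : List ℕ⁺ → List ℕ⁺ → Set) → Reflexive _⊑_ → Transitive _⊑_ →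
  (∀ ws {x y} xs → x ≼ y → (ws ++ x ∷ xs) ⊑ (ws ++ y ∷ xs)) →
  ∀ {xs ys} → Pointwise _≼_ xs ys → ∀ ws → (ws ++ xs) ⊑ (ws ++ ys)
pointwise-chain _⊑_ ⊑-refl ⊑-trans step []             ws = ⊑-refl
pointwise-chain _⊑_ ⊑-refl ⊑-trans step {x ∷ xs} {y ∷ ys} (x≼y ∷ xs≼ys) ws =
  ⊑-trans (step ws xs x≼y)
    (subst₂ _⊑_ (++-assoc ws (y ∷ []) xs) (++-assoc ws (y ∷ []) ys)
      (pointwise-chain _⊑_ ⊑-refl ⊑-trans step xs≼ys (ws ++ y ∷ [])))

-- Distances in powers of paths

walk-lipschitz : ∀ {G : Graph n} {φ : Fin n → ℕ} {c} → (∀ {u v} → Graph.Adj G u v → φ v ≤ⁿ φ u + c) →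
                 ∀ j {u v} → Walk G j u v → φ v ≤ⁿ φ u + j * c
walk-lipschitz step zero    refl        = m≤m+n _ 0
walk-lipschitz {φ = φ} {c} step (suc j) {u} {v} (w , uw , p) = begin
  φ v                  ≤⟨ walk-lipschitz step j p ⟩
  φ w + j * c          ≤⟨ +-monoˡ-≤ (j * c) (step uw) ⟩
  φ u + c + j * c      ≡⟨ +-assoc (φ u) c (j * c) ⟩
  φ u + suc j * c      ∎
  where open ≤-Reasoning

-- The label serves as a potential: it rises by at most one along an edge of the path, hence by at
-- most `k` along an edge of the power.
path-power-dist : ∀ n k .{{_ : NonZero k}} {u v d} → dist (power (P n) k) u v ≤ⁿ d → toℕ v ≤ⁿ toℕ u + d * k
path-power-dist n k {u} {v} {d} dist≤d = begin
  toℕ v                                     ≤⟨ walk-lipschitz power-step _ (dist-walk (power (P n) k) u v) ⟩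
  toℕ u + dist (power (P n) k) u v * k      ≤⟨ +-monoʳ-≤ (toℕ u) (*-monoˡ-≤ k dist≤d) ⟩
  toℕ u + d * k                             ∎
  where
  open ≤-Reasoning
  path-step : ∀ {u v : Fin n} → ∣ toℕ u - toℕ v ∣ ≡ 1 → toℕ v ≤ⁿ toℕ u + 1
  path-step {u} {v} eq = ≤-trans (m≤n+∣n-m∣ (toℕ v) (toℕ u)) (≤-reflexive (cong (toℕ u +_) eq))
  power-step : ∀ {u v : Fin n} → u ≢ v × dist (P n) u v ≤ⁿ k → toℕ v ≤ⁿ toℕ u + k
  power-step {u} {v} (_ , d≤k) = begin
    toℕ v                        ≤⟨ walk-lipschitz path-step _ (dist-walk (P n) u v) ⟩
    toℕ u + dist (P n) u v * 1   ≡⟨ cong (toℕ u +_) (*-identityʳ _) ⟩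
    toℕ u + dist (P n) u v       ≤⟨ +-monoʳ-≤ (toℕ u) d≤k ⟩
    toℕ u + k                    ∎

count-toℕ-< : ∀ n m → count (λ v → toℕ v <? m) (allFin n) ≤ⁿ n ⊓ m
count-toℕ-< zero    m       = z≤n
count-toℕ-< (suc n) zero    = ≤-reflexive
  (cong length (filter-none (λ v → toℕ v <? 0) (All.universal (λ _ ()) (allFin (suc n)))))
count-toℕ-< (suc n) (suc m) = begin
  count (λ v → toℕ v <? suc m) (allFin (suc n))
    ≡⟨ cong length (filter-accept (λ v → toℕ v <? suc m) {zero} {tabulate {n = n} suc} z<s) ⟩
  suc (count (λ v → toℕ v <? suc m) (tabulate {n = n} suc))
    ≡⟨ cong (suc ∘ count (λ v → toℕ v <? suc m)) (map-tabulate {n = n} id suc) ⟨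
  suc (count (λ v → toℕ v <? suc m) (map suc (allFin n)))
    ≡⟨ cong suc (count-map (λ v → toℕ v <? suc m) suc (allFin n)) ⟩
  suc (count (λ v → suc (toℕ v) <? suc m) (allFin n))
    ≤⟨ s≤s (count-mono (λ v → suc (toℕ v) <? suc m) (λ v → toℕ v <? m) (All.universal (λ _ → s<s⁻¹) (allFin n))) ⟩
  suc (count (λ v → toℕ v <? m) (allFin n))                ≤⟨ s≤s (count-toℕ-< n m) ⟩
  suc (n ⊓ m)                                              ∎
  where open ≤-Reasoning

pairs-map : {C : Set} (f : B → B → C) (g : A → B) (xs : List A) → pairs f (map g xs) ≡ pairs (λ x y → f (g x) (g y)) xs
pairs-map f g []       = refl
pairs-map f g (x ∷ xs) = cong₂ _++_ (sym (map-∘ xs)) (pairs-map f g xs)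

-- Removing `zero` shifts all other labels by one and keeps the band condition, so the recursion is
-- again that of `bandSize`. In the pairs at `zero` the other label is at most `m`.
pairs-within-band : ∀ n m {Q : B → Set} (Q? : Decidable Q) (f : Fin n → Fin n → B) →
  (∀ {u v} → Q (f u v) → toℕ v ≤ⁿ toℕ u + m) → count Q? (pairs f (allFin n)) ≤ⁿ bandSize m n
pairs-within-band zero    m Q? f band = z≤n
pairs-within-band (suc n) m Q? f band = begin
  count Q? (pairs f (allFin (suc n)))
    ≡⟨ cong (λ vs → count Q? (pairs f (zero ∷ vs))) (map-tabulate {n = n} id suc) ⟨
  count Q? (pairs f (zero ∷ map suc (allFin n)))
    ≡⟨ count-pairs-∷ Q? f zero (map suc (allFin n)) ⟩
  count (Q? ∘ f zero) (map suc (allFin n)) + count Q? (pairs f (map suc (allFin n)))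
    ≡⟨ cong₂ _+_ (count-map (Q? ∘ f zero) suc (allFin n)) (cong (count Q?) (pairs-map f suc (allFin n))) ⟩
  count (λ v → Q? (f zero (suc v))) (allFin n) + count Q? (pairs (λ u v → f (suc u) (suc v)) (allFin n))
    ≤⟨ +-mono-≤ (≤-trans (count-mono _ (λ v → toℕ v <? m) (All.universal (λ _ → band) (allFin n))) (count-toℕ-< n m))
                (pairs-within-band n m Q? (λ u v → f (suc u) (suc v)) (s≤s⁻¹ ∘ band)) ⟩
  n ⊓ m + bandSize m n ∎
  where open ≤-Reasoning

-- Comparison with the power of a path

lipschitz-dist : ∀ G {u v w} → Graph.Adj (ConnectedGraph.graph G) v w → dist G u w ≤ⁿ suc (dist G u v)
lipschitz-dist G {u} {v} {w} vw = dist-min G u w _ (snoc (ConnectedGraph.graph G) _ (dist-walk G u v) vw)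

dist-refl : ∀ G u → dist G u u ≡ 0
dist-refl G u = n≤0⇒n≡0 (dist-min G u u 0 refl)

module _ {n k} .{{_ : NonZero k}} {G : Graph n} (conn : Connected G)
         {vs} (a : Accretion G k vs) (all : ∀ v → v ∈ vs) where

  private
    G′ P′ : ConnectedGraph
    G′ = ⟨ G , conn ⟩
    P′ = power (P n) k

  -- For every `d` the number `bandSize (d * k) n` separates the two counts: it bounds the one for
  -- the power of the path from above and the one for `G` from below.
  distances-dominated : Pointwise _≼_ (distanceSequence G′) (distanceSequence P′)
  distances-dominated = sorted-dominated (ordered G′) (ordered P′) lengths counts
    where
    ordered : ∀ H → AllPairs _≼_ (distanceSequence H)
    ordered H = Sorted⇒AllPairs (DecTotalOrder.totalOrder ℕ⁺-≤-decTotalOrder) (Sort.sort-↗ ℕ⁺-≤-decTotalOrder _)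

    length-distances : ∀ H → length (distanceSequence H) ≡ length (pairs (dist H) (allFin _))
    length-distances H = trans (sym (length-map value (distanceSequence H))) (↭-length (distances-↭ H))

    lengths : length (distanceSequence G′) ≡ length (distanceSequence P′)
    lengths = trans (length-distances G′)
      (trans (length-pairs (dist G′) (allFin n) (dist P′)) (sym (length-distances P′)))

    vs↭ : vs ↭ allFin n
    vs↭ = accretion-↭-allFin a all

    counts : ∀ d → count (λ a → value a ≤? d) (distanceSequence P′) ≤ⁿ count (λ a → value a ≤? d) (distanceSequence G′)
    counts d = begin
      count (λ a → value a ≤? d) (distanceSequence P′)  ≡⟨ count-distances P′ d ⟩
      count (_≤? d) (pairs (dist P′) (allFin n))
        ≤⟨ pairs-within-band n (d * k) (_≤? d) (dist P′) (path-power-dist n k) ⟩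
      bandSize (d * k) n
        ≡⟨ cong (bandSize (d * k)) (trans (↭-length vs↭) (length-tabulate {n = n} id)) ⟨
      bandSize (d * k) (length vs)
        ≤⟨ pairs-bound G (dist G′) (dist-refl G′) (λ {u} → lipschitz-dist G′ {u}) d a ⟩
      count (_≤? d) (pairs (dist G′) vs)
        ≡⟨ count-↭ (_≤? d) (pairs-↭ (dist G′) (dist-sym G′) vs↭) ⟩
      count (_≤? d) (pairs (dist G′) (allFin n))        ≡⟨ count-distances G′ d ⟨
      count (λ a → value a ≤? d) (distanceSequence G′)  ∎
      where open ≤-Reasoning

  nondecreasing-bound : ∀ I → NondecreasingDistanceBased I → I G′ ≤ I P′
  nondecreasing-bound I (g , I≈g , mono) l = proj₂ (I≈g P′)
    (pointwise-chain (λ xs ys → g xs ≤ g ys) (λ l → l) (λ p q l → q (p l)) (λ ws xs → mono ws xs)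
      distances-dominated [] (proj₁ (I≈g G′) l))

  nonincreasing-bound : ∀ I → NonincreasingDistanceBased I → I G′ ≥ I P′
  nonincreasing-bound I (g , I≈g , mono) l = proj₂ (I≈g G′)
    (pointwise-chain (λ xs ys → g xs ≥ g ys) (λ l → l) (λ p q l → p (q l)) (λ ws xs → mono ws xs)
      distances-dominated [] (proj₁ (I≈g P′) l))

-- Apollonian networks

corners : V × V × V → List V
corners (a , b , c) = a ∷ b ∷ c ∷ []

-- This invariant makes the three neighbours of an inserted vertex distinct and already present, as
-- the degree count requires.
stacking-faces : ∀ {fs} → Stacking {V} vs es fs →
                 All (λ f → Unique (corners f) × All (_∈ vs) (corners f)) fs
stacking-faces (triangle a≢b b≢c c≢a) =
  ((a≢b ∷ c≢a ∘ sym ∷ []) ∷ (b≢c ∷ []) ∷ [] ∷ [] ,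
    here refl ∷ there (here refl) ∷ there (there (here refl)) ∷ []) ∷
  ((c≢a ∘ sym ∷ a≢b ∷ []) ∷ (b≢c ∘ sym ∷ []) ∷ [] ∷ [] ,
    here refl ∷ there (there (here refl)) ∷ there (here refl) ∷ []) ∷ []
stacking-faces (insert {vs} {v = v} v∉vs fs↭ s) with All-resp-↭ fs↭ (stacking-faces s)
... | ((a≢b ∷ a≢c ∷ []) ∷ (b≢c ∷ []) ∷ [] ∷ [] , a∈ ∷ b∈ ∷ c∈ ∷ []) ∷ rest =
  triangular a≢b a∈ b∈ ∷ triangular b≢c b∈ c∈ ∷ triangular (a≢c ∘ sym) c∈ a∈ ∷
  All.map (Product.map₂ (All.map there)) rest
  where
  new : ∀ {x} → x ∈ vs → x ≢ v
  new x∈ refl = v∉vs x∈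
  triangular : ∀ {x y} → x ≢ y → x ∈ vs → y ∈ vs → Unique (x ∷ y ∷ v ∷ []) × All (_∈ v ∷ vs) (x ∷ y ∷ v ∷ [])
  triangular x≢y x∈ y∈ = (x≢y ∷ new x∈ ∷ []) ∷ (new y∈ ∷ []) ∷ [] ∷ [] , there x∈ ∷ there y∈ ∷ here refl ∷ []

stacking-accretion : ∀ (G : Graph n) {vs es fs} → Stacking vs es fs →
  (∀ {u v} → (u , v) ∈ es → Graph.Adj G u v) → Accretion G 3 vs
stacking-accretion G (triangle {a} {b} {c} a≢b b≢c c≢a) edge =
  -- The initial triangle is built in the order `c`, `b`, `a`, each vertex being joined to all
  -- earlier ones.
  add (λ { (here a≡b) → a≢b a≡b ; (there (here a≡c)) → c≢a (sym a≡c) ; (there (there ())) })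
      (≤-reflexive (sym (count-all (adj? a) (edge (here refl) ∷ symm (edge (there (there (here refl)))) ∷ [])))) $
  add (λ { (here b≡c) → b≢c b≡c ; (there ()) })
      (≤-reflexive (sym (count-all (adj? b) (edge (there (here refl)) ∷ [])))) $
  add (λ ()) z≤n []
  where open Graph G
stacking-accretion G (insert {v = v} v∉vs fs↭ s) edge with All-resp-↭ fs↭ (stacking-faces s)
... | (unique , a∈ ∷ b∈ ∷ c∈ ∷ []) ∷ _ =
  add v∉vs (≤-trans (m⊓n≤m 3 _) (count-unique (Graph.adj? G v) unique
        ((a∈ , edge (here refl)) ∷ (b∈ , edge (there (here refl))) ∷ (c∈ , edge (there (there (here refl)))) ∷ [])))
      (stacking-accretion G s (edge ∘ there ∘ there ∘ there))

-- Walks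

end : V → List V → V
end u []       = u
end u (v ∷ xs) = end v xs

steps : List V → List (V × V)
steps []           = []
steps (u ∷ [])     = []
steps (u ∷ v ∷ xs) = (u , v) ∷ steps (v ∷ xs)

Closed : List V → Set
Closed []       = ⊥
Closed (u ∷ xs) = end u xs ≡ u

end-++ : ∀ (u : V) xs {v ys} → end u (xs ++ v ∷ ys) ≡ end v ys
end-++ u []       = refl
end-++ u (x ∷ xs) = end-++ x xs

end-∈ : ∀ (u : V) xs → end u xs ∈ u ∷ xs
end-∈ u []       = here refl
end-∈ u (x ∷ xs) = there (end-∈ x xs)

unsnoc : ∀ (u : V) xs → ∃[ ys ] u ∷ xs ≡ ys ++ end u xs ∷ []
unsnoc u []       = [] , refl
unsnoc u (x ∷ xs) = let ys , eq = unsnoc x xs in u ∷ ys , cong (u ∷_) eq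

steps-++ : ∀ (u : V) xs {v ys} → steps (u ∷ xs ++ v ∷ ys) ≡ steps (u ∷ xs) ++ (end u xs , v) ∷ steps (v ∷ ys)
steps-++ u []       = refl
steps-++ u (x ∷ xs) = cong (_ ∷_) (steps-++ x xs)

sources : ∀ (u : V) xs → map proj₁ (steps (u ∷ xs)) ++ end u xs ∷ [] ≡ u ∷ xs
sources u []       = refl
sources u (x ∷ xs) = cong (u ∷_) (sources x xs)

targets : ∀ (u : V) (xs : List V) → u ∷ map proj₂ (steps (u ∷ xs)) ≡ u ∷ xs
targets u []       = refl
targets u (x ∷ xs) = cong (u ∷_) (targets x xs)

-- Sources omit the last entry of the walk and targets the first; in a closed walk these are the
-- same vertex.
closed-sources-targets : ∀ {w : List V} → Closed w → map proj₁ (steps w) ↭ map proj₂ (steps w)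
closed-sources-targets {w = u ∷ xs} closed = drop-∷ (begin
  u ∷ map proj₁ (steps (u ∷ xs))             ↭⟨ ∷↭∷ʳ u _ ⟩
  map proj₁ (steps (u ∷ xs)) ++ u ∷ []        ≡⟨ cong (λ x → map proj₁ (steps (u ∷ xs)) ++ x ∷ []) closed ⟨
  map proj₁ (steps (u ∷ xs)) ++ end u xs ∷ [] ≡⟨ trans (sources u xs) (sym (targets u xs)) ⟩
  u ∷ map proj₂ (steps (u ∷ xs))             ∎)
  where open PermutationReasoning

steps-∈ : ∀ {w : List V} {a b} → (a , b) ∈ steps w → a ∈ w × b ∈ w
steps-∈ {w = u ∷ xs} {a} {b} e =
  subst (a ∈_) (sources u xs) (∈-++⁺ˡ (∈-map⁺ proj₁ e)) , subst (b ∈_) (targets u xs) (there (∈-map⁺ proj₂ e))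

join-∈ : z ∈ (u ∷ xs) ++ (v ∷ ys) ++ u ∷ [] → z ∈ u ∷ xs ⊎ z ∈ v ∷ ys
join-∈ {u = u} {xs} {v} {ys} z∈ with ∈-++⁻ (u ∷ xs) z∈
... | inj₁ z∈xs = inj₁ z∈xs
... | inj₂ z∈ys with ∈-++⁻ (v ∷ ys) z∈ys
... | inj₁ z∈ys′      = inj₂ z∈ys′
... | inj₂ (here refl) = inj₁ (here refl)

split-⊆ˡ : u ∷ xs ++ v ∷ u ∷ [] ⊆ u ∷ xs ++ v ∷ ys
split-⊆ˡ {u = u} {xs} z∈ with ∈-++⁻ (u ∷ xs) z∈
... | inj₁ z∈xs              = ∈-++⁺ˡ z∈xs
... | inj₂ (here refl)         = ∈-++⁺ʳ (u ∷ xs) (here refl)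
... | inj₂ (there (here refl)) = here refl

split-⊆ʳ : v ∷ ys ++ v ∷ [] ⊆ u ∷ xs ++ v ∷ ys
split-⊆ʳ {v = v} {ys} {u = u} {xs} z∈ with ∈-++⁻ (v ∷ ys) z∈
... | inj₁ z∈ys      = ∈-++⁺ʳ (u ∷ xs) z∈ys
... | inj₂ (here refl) = ∈-++⁺ʳ (u ∷ xs) (here refl)

rotate-⊆ : v ∷ xs ++ v ∷ [] ⊆ u ∷ v ∷ xs
rotate-⊆ {v = v} {xs} z∈ with ∈-++⁻ (v ∷ xs) z∈
... | inj₁ z∈xs      = there z∈xs
... | inj₂ (here refl) = there (here refl)

-- Invariants of plane drawings

WellFormed : List V → Face V → Set
WellFormed vs (_ , ws) = All (λ w → Closed w × w ⊆ vs) ws × AllPairs Disjoint ws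

private
  closed-⊆-∷ : ∀ {w} → Closed {V} w × w ⊆ vs → Closed w × w ⊆ v ∷ vs
  closed-⊆-∷ (c , w⊆) = c , λ z∈ → there (w⊆ z∈)

  disjoint-⊆ : ∀ {w w₁ x : List V} → w ⊆ w₁ → Disjoint w₁ x → Disjoint w x
  disjoint-⊆ w⊆ d (z∈ , z∈x) = d (w⊆ z∈ , z∈x)

  disjoint-∪ : ∀ {w w₁ w₂ x : List V} → (∀ {z} → z ∈ w → z ∈ w₁ ⊎ z ∈ w₂) →
               Disjoint w₁ x × Disjoint w₂ x → Disjoint w x
  disjoint-∪ w⊆ (d₁ , d₂) (z∈ , z∈x) = Sum.[ (λ z∈₁ → d₁ (z∈₁ , z∈x)) , (λ z∈₂ → d₂ (z∈₂ , z∈x)) ] (w⊆ z∈)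

  allPairs-++⁻ : ∀ {A : Set} {R : A → A → Set} xs {ys} → AllPairs R (xs ++ ys) → AllPairs R xs × AllPairs R ys
  allPairs-++⁻ []       rs       = [] , rs
  allPairs-++⁻ (x ∷ xs) (r ∷ rs) = Product.map₁ (All.++⁻ˡ xs r ∷_) (allPairs-++⁻ xs rs)

-- Closedness is what permits rotating and recutting the walks. Disjointness of the walks of a face
-- later shows that an edge joining two of them has distinct ends.
drawing-wellFormed : ∀ {fs} → Drawing {V} vs es fs → All (WellFormed vs) fs
drawing-wellFormed blank = ([] , []) ∷ []
drawing-wellFormed (vertex v∉vs D) with (ws , ds) ∷ rest ← drawing-wellFormed D =
  ((refl , λ { (here refl) → here refl }) ∷ All.map closed-⊆-∷ ws ,
   All.map (λ { (_ , w⊆vs) (here refl , v∈w) → v∉vs (w⊆vs v∈w) }) ws ∷ ds) ∷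
  All.map (Product.map₁ (All.map closed-⊆-∷)) rest
drawing-wellFormed (join {u = u} {v} {xs} {ys} _ D)
  with ((c₁ , ⊆₁) ∷ (c₂ , ⊆₂) ∷ ws , (d₁₂ ∷ d₁) ∷ d₂ ∷ ds) ∷ rest ← drawing-wellFormed D =
  ((trans (end-++ u xs) (end-++ v ys) , Sum.[ ⊆₁ , ⊆₂ ] ∘ join-∈ {xs = xs}) ∷ ws ,
   All.zipWith (disjoint-∪ (join-∈ {xs = xs})) (d₁ , d₂) ∷ ds) ∷
  rest
drawing-wellFormed (split {f = f} {g} {u = u} {v} {xs} {ys} _ D)
  with ((c , w⊆) ∷ ws , d ∷ ds) ∷ rest ← drawing-wellFormed D =
  ((end-++ u xs , w⊆ ∘ split-⊆ˡ {xs = xs}) ∷ All.++⁻ˡ f ws ,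
   All.map (disjoint-⊆ (split-⊆ˡ {xs = xs})) (All.++⁻ˡ f d) ∷ proj₁ (allPairs-++⁻ f ds)) ∷
  ((end-++ v ys , w⊆ ∘ split-⊆ʳ {xs = xs}) ∷ All.++⁻ʳ f ws ,
   All.map (disjoint-⊆ (split-⊆ʳ {xs = xs})) (All.++⁻ʳ f d) ∷ proj₂ (allPairs-++⁻ f ds)) ∷
  rest
drawing-wellFormed (rotate {v = v} {xs} D) with ((c , w⊆) ∷ ws , d ∷ ds) ∷ rest ← drawing-wellFormed D =
  ((end-++ v xs , w⊆ ∘ rotate-⊆) ∷ ws , All.map (disjoint-⊆ rotate-⊆) d ∷ ds) ∷ rest
drawing-wellFormed (reorderWalks f↭ D) with (ws , ds) ∷ rest ← drawing-wellFormed D =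
  (All-resp-↭ f↭ ws ,
   ↭ₛ.AllPairs-resp-↭ (setoid _) {R = Disjoint} Disjoint.sym
     ((λ { refl d → d }) , (λ { refl d → d })) (↭⇒↭ₛ f↭) ds) ∷ rest
drawing-wellFormed (reorderFaces fs↭ D) = All-resp-↭ fs↭ (drawing-wellFormed D)

swapped : V × V → V × V
swapped (u , v) = v , u

arcs : List (V × V) → List (V × V)
arcs []       = []
arcs (e ∷ es) = e ∷ swapped e ∷ arcs es

traversed : List (Face V) → List (V × V)
traversed = concatMap (concatMap steps ∘ proj₂)

concatMap-↭ : ∀ {A B : Set} (f : A → List B) {xs ys} → xs ↭ ys → concatMap f xs ↭ concatMap f ys
concatMap-↭ f _↭_.refl        = ↭-refl
concatMap-↭ f (prep x p)       = ++⁺ˡ (f x) (concatMap-↭ f p)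
concatMap-↭ f (swap x y p)     = ↭-trans (shifts (f x) (f y)) (++⁺ˡ (f y) (++⁺ˡ (f x) (concatMap-↭ f p)))
concatMap-↭ f (_↭_.trans p q)  = ↭-trans (concatMap-↭ f p) (concatMap-↭ f q)

-- `join` and `split` each insert the two directions of the new edge and only redistribute the other
-- steps; the remaining constructors add no steps. So every edge is traversed once each way.
drawing-traversed : ∀ {fs} → Drawing {V} vs es fs → traversed fs ↭ arcs es
drawing-traversed blank        = ↭-refl
drawing-traversed (vertex _ D) = drawing-traversed D
drawing-traversed {V} (join {es = es} {f = f} {fs} {u} {v} {xs} {ys} _ D)
  with ((c₁ , _) ∷ (c₂ , _) ∷ _ , _) ∷ _ ← drawing-wellFormed D = begin
  (steps ((u ∷ xs) ++ (v ∷ ys) ++ u ∷ []) ++ F) ++ T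
    ≡⟨ cong (λ s → (s ++ F) ++ T) (trans (steps-++ u xs)
         (cong₂ (λ e s → X ++ (e , v) ∷ s) c₁ (trans (steps-++ v ys) (cong (λ e → Y ++ (e , u) ∷ []) c₂)))) ⟩
  ((X ++ uv ++ Y ++ vu) ++ F) ++ T
    ↭⟨ solve 6 (λ X uv Y vu F T → ((X ⊕ uv ⊕ Y ⊕ vu) ⊕ F) ⊕ T ⊜ uv ⊕ vu ⊕ (X ⊕ Y ⊕ F) ⊕ T) ↭-refl X uv Y vu F T ⟩
  uv ++ vu ++ (X ++ Y ++ F) ++ T
    ↭⟨ prep _ (prep _ (drawing-traversed D)) ⟩
  arcs ((u , v) ∷ es) ∎
  where
  open PermutationReasoning
  open CommutativeMonoidSolver (++-commutativeMonoid {A = V × V})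
  X Y F T uv vu : List (V × V)
  X = steps (u ∷ xs)
  Y = steps (v ∷ ys)
  F = concatMap steps f
  T = traversed fs
  uv = (u , v) ∷ []
  vu = (v , u) ∷ []
drawing-traversed {V} (split {es = es} {f = f} {g} {fs} {u} {v} {xs} {ys} _ D)
  with ((c , _) ∷ _ , _) ∷ _ ← drawing-wellFormed D = begin
  (steps (u ∷ xs ++ v ∷ u ∷ []) ++ F) ++ (steps (v ∷ ys ++ v ∷ []) ++ H) ++ T
    ≡⟨ cong₂ (λ s s′ → (s ++ F) ++ (s′ ++ H) ++ T) (steps-++ u xs)
         (trans (steps-++ v ys) (cong (λ e → Y ++ (e , v) ∷ []) (trans (sym (end-++ u xs)) c))) ⟩
  ((X ++ e ++ vu) ++ F) ++ ((Y ++ uv) ++ H) ++ T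
    ↭⟨ solve 8 (λ X e vu F Y uv H T → ((X ⊕ e ⊕ vu) ⊕ F) ⊕ ((Y ⊕ uv) ⊕ H) ⊕ T ⊜ uv ⊕ vu ⊕ ((X ⊕ e ⊕ Y) ⊕ F ⊕ H) ⊕ T)
         ↭-refl X e vu F Y uv H T ⟩
  uv ++ vu ++ ((X ++ e ++ Y) ++ F ++ H) ++ T
    ≡⟨ cong₂ (λ s s′ → uv ++ vu ++ (s ++ s′) ++ T) (steps-++ u xs) (concatMap-++ steps f g) ⟨
  uv ++ vu ++ (steps (u ∷ xs ++ v ∷ ys) ++ concatMap steps (f ++ g)) ++ T
    ↭⟨ prep _ (prep _ (drawing-traversed D)) ⟩
  arcs ((u , v) ∷ es) ∎
  where
  open PermutationReasoning
  open CommutativeMonoidSolver (++-commutativeMonoid {A = V × V})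
  X Y F H T e uv vu : List (V × V)
  X = steps (u ∷ xs)
  Y = steps (v ∷ ys)
  F = concatMap steps f
  H = concatMap steps g
  T = traversed fs
  e = (end u xs , v) ∷ []
  uv = (u , v) ∷ []
  vu = (v , u) ∷ []
drawing-traversed (rotate {f = f} {fs} {u = u} {v} {xs} D)
  with ((c , _) ∷ _ , _) ∷ _ ← drawing-wellFormed D =
  ↭-trans (++⁺ʳ _ (++⁺ʳ _ (↭-trans (↭-reflexive (trans (steps-++ v xs) (cong (λ e → steps (v ∷ xs) ++ (e , v) ∷ []) c)))
                                     (↭-sym (∷↭∷ʳ _ _)))))
    (drawing-traversed D)
drawing-traversed (reorderWalks {fs = fs} f↭ D) =
  ↭-trans (++⁺ʳ (traversed fs) (concatMap-↭ steps (↭-sym f↭))) (drawing-traversed D)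
drawing-traversed (reorderFaces fs↭ D) =
  ↭-trans (concatMap-↭ (concatMap steps ∘ proj₂) (↭-sym fs↭)) (drawing-traversed D)

arcs-swapped : (es : List (V × V)) → map swapped (arcs es) ↭ arcs es
arcs-swapped []             = ↭-refl
arcs-swapped (e ∷ es) = swap _ _ (arcs-swapped es)

arcs-edge : (u , v) ∈ arcs es → IsEdge es u v
arcs-edge {es = _ ∷ _} (here refl)         = inj₁ (here refl)
arcs-edge {es = _ ∷ _} (there (here refl)) = inj₂ (here refl)
arcs-edge {es = _ ∷ _} (there (there e))   = Sum.map there there (arcs-edge e)

-- Rotating boundary walks

rotateTo : ∀ {vs es s f fs u v} xs {ys} → end v ys ≡ u →
  Drawing {V} vs es ((s , (u ∷ xs ++ v ∷ ys) ∷ f) ∷ fs) →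
  Drawing vs es ((s , (v ∷ ys ++ xs ++ v ∷ []) ∷ f) ∷ fs)
rotateTo []       _      D = rotate D
rotateTo {vs = vs} {es} {s} {f} {fs} {u} {v} (x ∷ xs) {ys} closed D =
  subst (λ w → Drawing vs es ((s , (v ∷ w) ∷ f) ∷ fs)) (++-assoc ys (x ∷ []) (xs ++ v ∷ [])) $
  rotateTo xs (end-++ v ys) $
  subst (λ w → Drawing vs es ((s , (x ∷ w) ∷ f) ∷ fs)) (++-assoc xs (v ∷ ys) (x ∷ [])) $
  rotate D

-- The start `u` dropped by the rotation survives as the last vertex of `v ∷ ys`.
rotateTo-⊇ : ∀ {u v : V} xs {ys} → end v ys ≡ u → u ∷ xs ++ v ∷ ys ⊆ v ∷ ys ++ xs ++ v ∷ []
rotateTo-⊇ {v = v} xs {ys} refl (here refl) = ∈-++⁺ˡ (end-∈ v ys)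
rotateTo-⊇ {v = v} xs {ys} closed (there z∈) with ∈-++⁻ xs z∈
... | inj₁ z∈xs = ∈-++⁺ʳ (v ∷ ys) (∈-++⁺ˡ z∈xs)
... | inj₂ z∈ys = ∈-++⁺ˡ z∈ys

startAt : ∀ {vs es s f fs w} {a : V} → Drawing vs es ((s , w ∷ f) ∷ fs) → a ∈ w →
          ∃[ w′ ] (Drawing vs es ((s , (a ∷ w′) ∷ f) ∷ fs) × w ⊆ a ∷ w′)
startAt {w = _ ∷ w} D (here refl) = w , D , id
startAt {w = u ∷ w} {a} D (there a∈w) with drawing-wellFormed D | ∈-∃++ a∈w
... | ((closed , _) ∷ _ , _) ∷ _ | xs , ys , refl =
  let closed′ = trans (sym (end-++ u xs)) closed
  in ys ++ xs ++ a ∷ [] , rotateTo xs closed′ D , rotateTo-⊇ xs closed′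

-- This puts the corner `x`, `u`, `y` at the close of the walk, where `split` can cut it off. If the
-- corner opens the walk, its `x` is recovered from the end of `post`, which `x ≢ y` makes nonempty.
startAfter : ∀ {vs es s f fs} pre {x u y : V} {post} → x ≢ y →
  Drawing vs es ((s , (pre ++ x ∷ u ∷ y ∷ post) ∷ f) ∷ fs) →
  ∃[ rest ] (Drawing vs es ((s , (y ∷ rest ++ x ∷ u ∷ y ∷ []) ∷ f) ∷ fs) ×
             pre ++ x ∷ u ∷ y ∷ post ⊆ y ∷ rest ++ x ∷ u ∷ y ∷ [])
startAfter {vs = vs} {es} {s} {f} {fs} [] {x} {u} {y} {post} x≢y D
  with ((closed , _) ∷ _ , _) ∷ _ ← drawing-wellFormed D | unsnoc y post
... | [] , refl = contradiction (sym closed) x≢y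
... | y ∷ rest , eq with refl ← ∷-injectiveˡ eq = rest , D′ , sub
  where
  eq′ : y ∷ post ++ u ∷ y ∷ [] ≡ y ∷ rest ++ x ∷ u ∷ y ∷ []
  eq′ = trans (cong (_++ u ∷ y ∷ []) (trans eq (cong (λ e → y ∷ rest ++ e ∷ []) closed)))
              (cong (y ∷_) (++-assoc rest (x ∷ []) (u ∷ y ∷ [])))
  D′ = subst (λ w → Drawing vs es ((s , w ∷ f) ∷ fs)) eq′ (rotateTo (u ∷ []) closed D)
  sub : x ∷ u ∷ y ∷ post ⊆ y ∷ rest ++ x ∷ u ∷ y ∷ []
  sub {z} z∈ = subst (z ∈_) eq′ (rotateTo-⊇ (u ∷ []) closed z∈)
startAfter {vs = vs} {es} {s} {f} {fs} (p ∷ pre) {x} {u} {y} {post} x≢y D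
  with ((closed , _) ∷ _ , _) ∷ _ ← drawing-wellFormed D = post ++ pre , D″ , sub
  where
  eq : p ∷ pre ++ x ∷ u ∷ y ∷ post ≡ p ∷ (pre ++ x ∷ u ∷ []) ++ y ∷ post
  eq = cong (p ∷_) (sym (++-assoc pre (x ∷ u ∷ []) (y ∷ post)))
  eq′ : y ∷ post ++ (pre ++ x ∷ u ∷ []) ++ y ∷ [] ≡ y ∷ (post ++ pre) ++ x ∷ u ∷ y ∷ []
  eq′ = cong (y ∷_) (trans (cong (post ++_) (++-assoc pre (x ∷ u ∷ []) (y ∷ []))) (sym (++-assoc post pre _)))
  closed′ : end y post ≡ p
  closed′ = trans (sym (end-++ p pre)) closed
  D″ = subst (λ w → Drawing vs es ((s , w ∷ f) ∷ fs)) eq′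
         (rotateTo (pre ++ x ∷ u ∷ []) closed′ (subst (λ w → Drawing vs es ((s , w ∷ f) ∷ fs)) eq D))
  sub : p ∷ pre ++ x ∷ u ∷ y ∷ post ⊆ y ∷ (post ++ pre) ++ x ∷ u ∷ y ∷ []
  sub {z} z∈ = subst (z ∈_) eq′ (rotateTo-⊇ (pre ++ x ∷ u ∷ []) closed′ (subst (z ∈_) eq z∈))

first-exit : {C : V → Set} → Decidable C → ∀ {p q z} xs → C p → C q → z ∈ xs → ¬ C z →
  ∃[ pre ] ∃[ x ] ∃[ u ] ∃[ y ] ∃[ post ] (p ∷ q ∷ xs ≡ pre ++ x ∷ u ∷ y ∷ post × C x × C u × ¬ C y)
first-exit C? {p} {q} (r ∷ xs) Cp Cq z∈ ¬Cz with C? r | z∈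
... | no ¬Cr | _         = [] , p , q , r , xs , refl , Cp , Cq , ¬Cr
... | yes Cr | here refl = contradiction Cr ¬Cz
... | yes Cr | there z∈xs =
  let pre , x , u , y , post , eq , CCC = first-exit C? xs Cq Cr z∈xs ¬Cz
  in p ∷ pre , x , u , y , post , cong (p ∷_) eq , CCC

private
  extract : ∀ {A : Set} {x : A} {xs} → x ∈ xs → ∃[ ys ] xs ↭ x ∷ ys
  extract x∈xs with ys , zs , refl ← ∈-∃++ x∈xs = ys ++ zs , shift _ ys zs

-- Maximal outerplanar graphs

module _ {G : Graph n} where
  open Graph G
  open DecMembership (Fin._≟_ {n}) using (_∈?_)

  -- Greedy extension with `m` as fuel: an accretion has no repetitions, hence at most `n` vertices,
  -- so the process gets stuck before the fuel runs out.
  grow : ∀ k m {vs} → n < length vs + m → Accretion G k vs →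
         ∃[ C ] (Accretion G k C × vs ⊆ C × (∀ {v} → k ⊓ length C ≤ⁿ count (adj? v) C → v ∈ C))
  grow k zero {vs} n< a = contradiction (begin-strict
    n                 <⟨ n< ⟩
    length vs + 0     ≡⟨ +-identityʳ _ ⟩
    length vs         ≤⟨ unique-length-≤ (accretion-unique G a) (λ {x} _ → ∈-allFin x) ⟩
    length (allFin n) ≡⟨ length-tabulate {n = n} id ⟩
    n                 ∎) (<-irrefl refl)
    where open ≤-Reasoning
  grow k (suc m) {vs} n< a with Fin.any? (λ v → ¬? (v ∈? vs) ×-dec (k ⊓ length vs ≤? count (adj? v) vs))
  ... | yes (v , v∉vs , deg) =
    let C , b , vs⊆ , stuck = grow k m (subst (n <_) (+-suc (length vs) m) n<) (add v∉vs deg a)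
    in C , b , vs⊆ ∘ there , stuck
  ... | no ¬more = vs , a , id , λ {v} deg → decidable-stable (v ∈? vs) λ v∉ → ¬more (v , v∉ , deg)

  module _ {vs es} (depicts : Depicts vs es G)
           (maximal : ∀ u v (u≢v : u ≢ v) → ¬ Adj u v → ¬ Outerplanar (addEdge G u v u≢v)) where

    Covers : List (List (Fin n)) → Set
    Covers f = ∀ v → ∃[ w ] (w ∈ f × v ∈ w)

    adjacent : ∀ {fs u v} → Drawing vs es fs → (u , v) ∈ traversed fs → Adj u v
    adjacent {u = u} {v} D e = Equivalence.from (proj₂ depicts u v) (arcs-edge (∈-resp-↭ (drawing-traversed D) e))

    Adj⇒≢ : ∀ {u v} → Adj u v → u ≢ v
    Adj⇒≢ a refl = irrefl a

    -- Contrapositive of maximality, with the double negation removed by decidability of adjacency.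
    -- To obtain an edge it thus suffices to draw it with all vertices still on the outer face.
    saturated : ∀ {u v} → u ≢ v →
      (Drawable es u v → ∃[ fs ] (Drawing vs ((u , v) ∷ es) fs × ∃[ f ] ((outer , f) ∈ fs × Covers f))) →
      Adj u v
    saturated {u} {v} u≢v draw = decidable-stable (adj? u v) λ ¬uv →
      let fs , D , covered = draw (u≢v , ¬uv ∘ Equivalence.from (proj₂ depicts u v))
      in maximal u v u≢v ¬uv (vs , (u , v) ∷ es , fs , D , (proj₁ depicts , λ x y → mk⇔ (to x y) (from x y)) , covered)
      where
      to : ∀ x y → Adj x y ⊎ ((x ≡ u × y ≡ v) ⊎ (x ≡ v × y ≡ u)) → IsEdge ((u , v) ∷ es) x y
      to x y (inj₁ a)                    = Sum.map there there (Equivalence.to (proj₂ depicts x y) a)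
      to x y (inj₂ (inj₁ (refl , refl))) = inj₁ (here refl)
      to x y (inj₂ (inj₂ (refl , refl))) = inj₂ (here refl)
      from : ∀ x y → IsEdge ((u , v) ∷ es) x y → Adj x y ⊎ ((x ≡ u × y ≡ v) ⊎ (x ≡ v × y ≡ u))
      from x y (inj₁ (here refl)) = inj₂ (inj₁ (refl , refl))
      from x y (inj₂ (here refl)) = inj₂ (inj₂ (refl , refl))
      from x y (inj₁ (there e))   = inj₁ (Equivalence.from (proj₂ depicts x y) (inj₁ e))
      from x y (inj₂ (there e))   = inj₁ (Equivalence.from (proj₂ depicts x y) (inj₂ e))

    -- Otherwise a chord can be drawn in the face, without affecting the outer face.
    inner-face-clique : ∀ {s w f fs g} → Drawing vs es ((s , w ∷ f) ∷ fs) → (outer , g) ∈ fs → Covers g →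
      ∀ {a b} → a ∈ w → b ∈ w → a ≢ b → Adj a b
    inner-face-clique D g∈ covers {a} {b} a∈w b∈w a≢b with startAt D a∈w
    ... | w′ , D′ , w⊆ with w⊆ b∈w
    ... | here b≡a = contradiction (sym b≡a) a≢b
    ... | there b∈w′ with xs , ys , refl ← ∈-∃++ b∈w′ =
      -- The choice `f = []` moves the other walks of this face to the new inner one. The covering
      -- face `g` is a separate entry and stays as it was.
      saturated a≢b λ drawable → _ , split {f = []} drawable D′ , _ , there (there g∈) , covers

    -- Otherwise an edge joining the two walks can be drawn in the outer face.
    outer-walks-adjacent : ∀ {w₁ w₂ f fs} → Drawing vs es ((outer , w₁ ∷ w₂ ∷ f) ∷ fs) → Covers (w₁ ∷ w₂ ∷ f) →
      ∀ {a b} → a ∈ w₁ → b ∈ w₂ → Adj a b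
    outer-walks-adjacent {w₁} {w₂} {f} D covers {a} {b} a∈ b∈
      with (_ , (d₁₂ ∷ _) ∷ _) ∷ _ ← drawing-wellFormed D
         | w₁′ , D₁ , ⊆₁ ← startAt D a∈
      with w₂′ , D₂ , ⊆₂ ← startAt (reorderWalks (swap _ _ ↭-refl) D₁) b∈ =
      symm (saturated b≢a λ drawable → _ , join drawable D₂ , _ , here refl , covers′)
      where
      b≢a : b ≢ a
      b≢a refl = d₁₂ (a∈ , b∈)
      covers′ : Covers (((b ∷ w₂′) ++ (a ∷ w₁′) ++ b ∷ []) ∷ f)
      covers′ v with covers v
      ... | _ , here refl , v∈           = _ , here refl , ∈-++⁺ʳ (b ∷ w₂′) (∈-++⁺ˡ (⊆₁ v∈))
      ... | _ , there (here refl) , v∈   = _ , here refl , ∈-++⁺ˡ (⊆₂ v∈)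
      ... | w , there (there w∈f) , v∈   = w , there w∈f , v∈

    inner-walk-clique : ∀ {s f g w fs} → Drawing vs es ((outer , f) ∷ fs) → Covers f → (s , g) ∈ fs → w ∈ g →
      ∀ {a b} → a ∈ w → b ∈ w → a ≢ b → Adj a b
    inner-walk-clique D covers g∈ w∈ =
      let _ , fs↭ = extract g∈
          _ , g↭  = extract w∈
      in inner-face-clique
           (reorderWalks g↭ (reorderFaces (↭-trans (prep _ fs↭) (swap _ _ ↭-refl)) D)) (here refl) covers

    walk-adjacent : ∀ {s f w fs} → Drawing vs es fs → (s , f) ∈ fs → w ∈ f → ∀ {a b} → (a , b) ∈ steps w → Adj a b
    walk-adjacent D f∈ w∈ e = adjacent D
      (∈-concatMap⁺ (concatMap steps ∘ proj₂) (lose f∈ (∈-concatMap⁺ steps (lose w∈ e))))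

    Stuck : List (Fin n) → Set
    Stuck C = ∀ {v x y} → x ∈ C → y ∈ C → x ≢ y → Adj v x → Adj v y → v ∈ C

    edge-closure : ∀ {p q} → Adj p q → ∃[ C ] (Accretion G 2 C × Stuck C × p ∈ C × q ∈ C)
    edge-closure {p} {q} pq =
      let C , a , ⊆C , closed = grow 2 (suc n) (m≤n⇒m≤1+n (m≤n+m (suc n) 1)) seed
      in C , a ,
         (λ {v} x∈ y∈ x≢y vx vy → closed (≤-trans (m⊓n≤m 2 _)
           (count-unique (adj? v) ((x≢y ∷ []) ∷ [] ∷ []) ((x∈ , vx) ∷ (y∈ , vy) ∷ [])))) ,
         ⊆C (there (here refl)) , ⊆C (here refl)
      where
      seed : Accretion G 2 (q ∷ p ∷ [])
      seed = add (λ { (here q≡p) → Adj⇒≢ pq (sym q≡p) ; (there ()) })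
                 (≤-reflexive (sym (count-all (adj? q) (symm pq ∷ []))))
                 (add (λ ()) z≤n [])

    -- After `b`, each vertex of the walk has two neighbours in `C`, the apex `a` and its
    -- predecessor; these are distinct, being adjacent.
    cone-⊆ : ∀ {C} → Stuck C → ∀ {a} b ys → a ∈ C → b ∈ C → (∀ {z} → z ∈ b ∷ ys → Adj z a) →
      (∀ {p q} → (p , q) ∈ steps (b ∷ ys) → Adj p q) → b ∷ ys ⊆ C
    cone-⊆ stuck b ys       a∈C b∈C cone edge (here refl) = b∈C
    cone-⊆ stuck b (y ∷ ys) a∈C b∈C cone edge (there z∈)  =
      cone-⊆ stuck y ys a∈C
        (stuck a∈C b∈C (Adj⇒≢ (symm (cone (here refl)))) (cone (there (here refl))) (symm (edge (here refl))))
        (cone ∘ there) (edge ∘ there) z∈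

    -- Vertices on different outer walks are adjacent, so the closure of one such edge, from `a` to
    -- `b`, is everything: the walk of `a` is a cone with apex `b`, the walk of `b` one with apex
    -- `a`, and a vertex of any further walk is adjacent to both.
    several-outer-walks : ∀ {w₁ w₂ f fs} → Drawing vs es ((outer , w₁ ∷ w₂ ∷ f) ∷ fs) → Covers (w₁ ∷ w₂ ∷ f) →
      ∃[ C ] (Accretion G 2 C × (∀ v → v ∈ C))
    several-outer-walks D covers with drawing-wellFormed D
    several-outer-walks {[]}         D covers | ((() , _) ∷ _ , _) ∷ _
    several-outer-walks {_ ∷ _} {[]} D covers | (_ ∷ (() , _) ∷ _ , _) ∷ _
    several-outer-walks {a ∷ xs} {b ∷ ys} {f} D covers | _ =
      let C , acc , stuck , a∈C , b∈C = edge-closure (outer-walks-adjacent D covers (here refl) (here refl))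
      in C , acc , everything stuck a∈C b∈C
      where
      third : ∀ {w v} → w ∈ f → v ∈ w → Adj v a × Adj v b
      third w∈ v∈ =
        let f′ , f↭ = extract w∈
            σ = ↭-trans (prep (a ∷ xs) (prep (b ∷ ys) f↭)) (prep _ (swap _ _ ↭-refl))
            τ = ↭-trans (swap (a ∷ xs) (b ∷ ys) f↭) (prep _ (swap _ _ ↭-refl))
        in symm (outer-walks-adjacent (reorderWalks σ D) (reorder σ) (here refl) v∈) ,
           symm (outer-walks-adjacent (reorderWalks τ D) (reorder τ) (here refl) v∈)
        where
        reorder : ∀ {g} → (a ∷ xs) ∷ (b ∷ ys) ∷ f ↭ g → Covers g
        reorder σ v = let w , w∈ , v∈ = covers v in w , ∈-resp-↭ σ w∈ , v∈

      everything : ∀ {C} → Stuck C → a ∈ C → b ∈ C → ∀ v → v ∈ C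
      everything stuck a∈C b∈C v with covers v
      ... | _ , here refl , v∈ = cone-⊆ stuck a xs b∈C a∈C
        (λ z∈ → outer-walks-adjacent D covers z∈ (here refl))
        (walk-adjacent D (here refl) (here refl)) v∈
      ... | _ , there (here refl) , v∈ = cone-⊆ stuck b ys a∈C b∈C
        (λ z∈ → symm (outer-walks-adjacent D covers (here refl) z∈))
        (walk-adjacent D (here refl) (there (here refl))) v∈
      ... | w , there (there w∈) , v∈ = let va , vb = third w∈ v∈ in
        stuck a∈C b∈C (Adj⇒≢ (outer-walks-adjacent D covers (here refl) (here refl))) va vb

    -- Arcs between a stuck set and one of its vertices

    module _ (C : List (Fin n)) (stuck : Stuck C) {u} (u∈C : u ∈ C) where

      Enters : Fin n × Fin n → Set
      Enters (a , b) = a ∈ C × b ≡ u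

      enters? : Decidable Enters
      enters? (a , b) = (a ∈? C) ×-dec (b Fin.≟ u)

      -- An arc whose reversal satisfies `Enters` leads from `u` into `C`, so the right-hand side
      -- counts departures from `u` to `C`.
      Balanced : List (Fin n × Fin n) → Set
      Balanced E = count enters? E ≡ count enters? (map swapped E)

      balanced-++ : ∀ {E F} → Balanced E → Balanced F → Balanced (E ++ F)
      balanced-++ {E} {F} b c = begin
        count enters? (E ++ F)                                            ≡⟨ count-++ enters? E F ⟩
        count enters? E + count enters? F                                 ≡⟨ cong₂ _+_ b c ⟩
        count enters? (map swapped E) + count enters? (map swapped F)
          ≡⟨ count-++ enters? (map swapped E) (map swapped F) ⟨
        count enters? (map swapped E ++ map swapped F)
          ≡⟨ cong (count enters?) (map-++ swapped E F) ⟨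
        count enters? (map swapped (E ++ F))                              ∎
        where open ≡-Reasoning

      balanced-concatMap : ∀ {A : Set} (f : A → List (Fin n × Fin n)) {xs} →
        All (Balanced ∘ f) xs → Balanced (concatMap f xs)
      balanced-concatMap f []       = refl
      balanced-concatMap f {x ∷ xs} (b ∷ bs) = balanced-++ {f x} {concatMap f xs} b (balanced-concatMap f bs)

      -- If some step has both ends in `C`, every other vertex of the clique is adjacent to both, so
      -- the walk lies in `C`; the counts are then those of all arrivals at and departures from `u`,
      -- equal in a closed walk. Otherwise both counts are zero, as `u` itself is in `C`.
      clique-walk-balanced : ∀ {w} → Closed w → (∀ {a b} → a ∈ w → b ∈ w → a ≢ b → Adj a b) →
        (∀ {a b} → (a , b) ∈ steps w → Adj a b) → Balanced (steps w)
      clique-walk-balanced {w} closed clique edge with any? (λ (a , b) → (a ∈? C) ×-dec (b ∈? C)) (steps w)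
      ... | no ¬inside = trans
        (cong length (filter-none enters? (All.map (λ { ¬in (a∈C , refl) → ¬in (a∈C , u∈C) }) none)))
        (sym (cong length (filter-none enters? (All.map⁺ (All.map (λ { ¬in (b∈C , refl) → ¬in (u∈C , b∈C) }) none)))))
        where none = ¬Any⇒All¬ (steps w) ¬inside
      ... | yes inside with (a , b) , e , a∈C , b∈C ← find inside = begin
        count enters? (steps w)
          ≡⟨ ≤-antisym (count-mono enters? (λ e → proj₂ e Fin.≟ u) (All.universal (λ _ → proj₂) (steps w)))
          (count-mono (λ e → proj₂ e Fin.≟ u) enters? {steps w}
            (All.tabulate λ e b≡u → w⊆C (proj₁ (steps-∈ e)) , b≡u)) ⟩
        count (λ e → proj₂ e Fin.≟ u) (steps w)      ≡⟨ count-map (Fin._≟ u) proj₂ (steps w) ⟨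
        count (Fin._≟ u) (map proj₂ (steps w))       ≡⟨ count-↭ (Fin._≟ u) (closed-sources-targets closed) ⟨
        count (Fin._≟ u) (map proj₁ (steps w))       ≡⟨ count-map (Fin._≟ u) proj₁ (steps w) ⟩
        count (λ e → proj₁ e Fin.≟ u) (steps w)
          ≡⟨ ≤-antisym (count-mono (λ e → proj₁ e Fin.≟ u) (enters? ∘ swapped) {steps w}
            (All.tabulate λ e a≡u → w⊆C (proj₂ (steps-∈ e)) , a≡u))
          (count-mono (enters? ∘ swapped) (λ e → proj₁ e Fin.≟ u) (All.universal (λ _ → proj₂) (steps w))) ⟩
        count (enters? ∘ swapped) (steps w)          ≡⟨ count-map enters? swapped (steps w) ⟨
        count enters? (map swapped (steps w))        ∎
        where
        open ≡-Reasoning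
        w⊆C : w ⊆ C
        w⊆C {z} z∈ with z Fin.≟ a | z Fin.≟ b
        ... | yes refl | _        = a∈C
        ... | no _     | yes refl = b∈C
        ... | no z≢a   | no z≢b   = stuck a∈C b∈C (Adj⇒≢ (edge e))
          (clique z∈ (proj₁ (steps-∈ e)) z≢a) (clique z∈ (proj₂ (steps-∈ e)) z≢b)

      inner-balanced : ∀ {f fs} → Drawing vs es ((outer , f) ∷ fs) → Covers f → Balanced (traversed fs)
      inner-balanced {fs = fs} D covers with _ ∷ wf ← drawing-wellFormed D =
        balanced-concatMap (concatMap steps ∘ proj₂) {fs} (All.tabulate λ {(s , g)} g∈ →
          balanced-concatMap steps (All.tabulate λ w∈ →
          clique-walk-balanced (proj₁ (All.lookup (proj₁ (All.lookup wf g∈)) w∈))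
            (inner-walk-clique D covers g∈ w∈) (walk-adjacent D (there g∈) w∈)))

      -- Over all faces each edge is traversed once each way, so reversing every arc only permutes
      -- the list.
      total-balanced : ∀ {fs} → Drawing vs es fs → Balanced (traversed fs)
      total-balanced D = count-↭ enters?
        (↭-trans ↭arcs (↭-trans (↭-sym (arcs-swapped es)) (map⁺ swapped (↭-sym ↭arcs))))
        where ↭arcs = drawing-traversed D

      -- As many arcs lead from C to u as from u to C.  Each inner walk contributes equally to both
      -- numbers, whereas the outer walk would not if it passed through u only between x and y.
      no-exit : ∀ {x y rest fs} → x ∈ C → y ∉ C →
        Drawing vs es ((outer , (y ∷ rest ++ x ∷ u ∷ y ∷ []) ∷ []) ∷ fs) →
        (∀ v → v ∈ y ∷ rest ++ x ∷ u ∷ y ∷ []) → ⊥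
      no-exit {x} {y} {rest} {fs} x∈C y∉C D whole = case u ∈? rest of λ
        -- A second passage through `u` makes `y` adjacent to `x` as well as to `u`, which would put
        -- `y` into `C`.
        { (yes u∈rest) → y∉C (stuck x∈C u∈C (Adj⇒≢ xu) (yx u∈rest) (symm uy))
        ; (no u∉rest)  → unbalanced u∉rest }
        where
        W = y ∷ rest ++ x ∷ u ∷ y ∷ []

        x≢y : x ≢ y
        x≢y refl = y∉C x∈C

        u≢y : u ≢ y
        u≢y refl = y∉C u∈C

        steps-W : steps W ≡ steps (y ∷ rest ++ x ∷ []) ++ (x , u) ∷ (u , y) ∷ []
        steps-W = begin
          steps (y ∷ rest ++ x ∷ u ∷ y ∷ [])
            ≡⟨ cong (λ r → steps (y ∷ r)) (++-assoc rest (x ∷ []) _) ⟨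
          steps (y ∷ (rest ++ x ∷ []) ++ u ∷ y ∷ [])   ≡⟨ steps-++ y (rest ++ x ∷ []) ⟩
          steps (y ∷ rest ++ x ∷ []) ++ (end y (rest ++ x ∷ []) , u) ∷ (u , y) ∷ []
            ≡⟨ cong (λ e → steps (y ∷ rest ++ x ∷ []) ++ (e , u) ∷ (u , y) ∷ []) (end-++ y rest) ⟩
          steps (y ∷ rest ++ x ∷ []) ++ (x , u) ∷ (u , y) ∷ [] ∎
          where open ≡-Reasoning

        xu : Adj x u
        xu = walk-adjacent D (here refl) (here refl)
          (subst ((x , u) ∈_) (sym steps-W) (∈-++⁺ʳ (steps (y ∷ rest ++ x ∷ [])) (here refl)))

        uy : Adj u y
        uy = walk-adjacent D (here refl) (here refl)
          (subst ((u , y) ∈_) (sym steps-W) (∈-++⁺ʳ (steps (y ∷ rest ++ x ∷ [])) (there (here refl))))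

        -- The chord cuts off the corner as a triangle `x`, `u`, `y`; the other occurrence in `rest`
        -- keeps `u` on the outer face.
        yx : u ∈ rest → Adj y x
        yx u∈rest = saturated (x≢y ∘ sym) λ drawable → _ , split {f = []} {g = []} drawable D , _ , here refl , covers
          where
          covers : Covers ((y ∷ rest ++ x ∷ y ∷ []) ∷ [])
          covers v with ∈-++⁻ (y ∷ rest) (whole v)
          ... | inj₁ v∈                          = _ , here refl , ∈-++⁺ˡ v∈
          ... | inj₂ (here refl)                 = _ , here refl , ∈-++⁺ʳ (y ∷ rest) (here refl)
          ... | inj₂ (there (here refl))         = _ , here refl , there (∈-++⁺ˡ u∈rest)
          ... | inj₂ (there (there (here refl))) = _ , here refl , here refl

        module _ (u∉rest : u ∉ rest) where

          u∉ : u ∉ y ∷ rest ++ x ∷ []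
          u∉ u∈ with ∈-++⁻ (y ∷ rest) u∈
          ... | inj₁ (here u≡y)      = u≢y u≡y
          ... | inj₁ (there u∈rest)  = u∉rest u∈rest
          ... | inj₂ (here u≡x)      = Adj⇒≢ xu (sym u≡x)

          E : List (Fin n × Fin n)
          E = steps (y ∷ rest ++ x ∷ [])

          -- The walk meets `u` only in its last two steps. Of these `(x , u)` comes from `C`,
          -- whereas `(u , y)` goes to a vertex outside; hence one here and zero in `leaving`.
          entering : count enters? (steps W) ≡ 1
          entering = begin
            count enters? (steps W)
              ≡⟨ cong (count enters?) steps-W ⟩
            count enters? (E ++ (x , u) ∷ (u , y) ∷ [])                       ≡⟨ count-++ enters? E _ ⟩
            count enters? E + count enters? ((x , u) ∷ (u , y) ∷ [])
              ≡⟨ cong₂ _+_ (cong length (filter-none enters? (All.tabulate λ { e (_ , refl) → u∉ (proj₂ (steps-∈ e)) })))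
                           (cong length (trans (filter-accept enters? (x∈C , refl))
                             (cong ((x , u) ∷_) (filter-reject enters? (u≢y ∘ sym ∘ proj₂))))) ⟩
            1                                                                 ∎
            where open ≡-Reasoning

          leaving : count enters? (map swapped (steps W)) ≡ 0
          leaving = begin
            count enters? (map swapped (steps W))
              ≡⟨ cong (count enters? ∘ map swapped) steps-W ⟩
            count enters? (map swapped (E ++ (x , u) ∷ (u , y) ∷ []))
              ≡⟨ cong (count enters?) (map-++ swapped E _) ⟩
            count enters? (map swapped E ++ (u , x) ∷ (y , u) ∷ [])
              ≡⟨ cong length (filter-none enters? {map swapped E ++ (u , x) ∷ (y , u) ∷ []}
                   (All.++⁺ (All.map⁺ (All.tabulate λ { e (_ , refl) → u∉ (proj₁ (steps-∈ e)) }))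
                   ((Adj⇒≢ xu ∘ proj₂) ∷ (y∉C ∘ proj₁) ∷ []))) ⟩
            0                                                                 ∎
            where open ≡-Reasoning

          unbalanced : ⊥
          unbalanced = 1+n≢n (begin
            1 + count enters? T
              ≡⟨ cong (_+ _) (trans (cong (count enters?) (++-identityʳ (steps W))) entering) ⟨
            count enters? (steps W ++ []) + count enters? T
              ≡⟨ count-++ enters? (steps W ++ []) T ⟨
            count enters? ((steps W ++ []) ++ T)                              ≡⟨ total-balanced D ⟩
            count enters? (map swapped ((steps W ++ []) ++ T))
              ≡⟨ cong (count enters?) (map-++ swapped (steps W ++ []) T) ⟩
            count enters? (map swapped (steps W ++ []) ++ map swapped T)
              ≡⟨ count-++ enters? (map swapped (steps W ++ [])) _ ⟩
            count enters? (map swapped (steps W ++ [])) + count enters? (map swapped T)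
              ≡⟨ cong₂ _+_ (trans (cong (count enters? ∘ map swapped) (++-identityʳ (steps W))) leaving)
                           (sym (inner-balanced D λ v → _ , here refl , whole v)) ⟩
            count enters? T                                                   ∎)
            where
            open ≡-Reasoning
            T = traversed fs

    -- The closure starts from the first edge of the walk, which exists since a walk of one vertex
    -- cannot contain both `a` and `b`. If it missed a vertex, the walk would first leave it right
    -- after two consecutive members, which `no-exit` excludes.
    single-outer-walk : ∀ {a b w fs} → a ≢ b → Drawing vs es ((outer , w ∷ []) ∷ fs) → (∀ v → v ∈ w) →
      ∃[ C ] (Accretion G 2 C × (∀ v → v ∈ C))
    single-outer-walk {a} {b} {[]} a≢b D whole with () ← whole a
    single-outer-walk {a} {b} {p ∷ []} a≢b D whole
      with here refl ← whole a | here refl ← whole b = contradiction refl a≢b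
    single-outer-walk {a} {b} {p ∷ q ∷ xs} {fs} a≢b D whole
      with C , acc , stuck , p∈C , q∈C ← edge-closure (walk-adjacent D (here refl) (here refl) (here refl)) =
      C , acc , λ z → decidable-stable (z ∈? C) λ z∉C → exit stuck p∈C q∈C z z∉C (whole z)
      where
      exit : ∀ {C} → Stuck C → p ∈ C → q ∈ C → ∀ z → z ∉ C → z ∈ p ∷ q ∷ xs → ⊥
      exit stuck p∈C q∈C z z∉C (here refl)         = z∉C p∈C
      exit stuck p∈C q∈C z z∉C (there (here refl)) = z∉C q∈C
      exit {C} stuck p∈C q∈C z z∉C (there (there z∈))
        with pre , x , u , y , post , eq , x∈C , u∈C , y∉C ← first-exit (_∈? C) xs p∈C q∈C z∈ z∉C
        with rest , D′ , W⊆ ← startAfter pre (λ { refl → y∉C x∈C })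
          (subst (λ w → Drawing vs es ((outer , w ∷ []) ∷ fs)) eq D) =
        no-exit C stuck u∈C x∈C y∉C D′ (λ v → W⊆ (subst (v ∈_) eq (whole v)))

    outer-face : ∀ {f} {a b : Fin n} {fs} → a ≢ b → Drawing vs es ((outer , f) ∷ fs) → Covers f →
      ∃[ C ] (Accretion G 2 C × (∀ v → v ∈ C))
    outer-face {[]} {a} a≢b D covers with _ , () , _ ← covers a
    outer-face {w ∷ []} a≢b D covers = single-outer-walk a≢b D λ v → case covers v of λ { (_ , here refl , v∈) → v∈ }
    outer-face {w₁ ∷ w₂ ∷ f} a≢b D covers = several-outer-walks D covers

maximalOuterplanar-accretion : ∀ {G : Graph n} {a b} → a ≢ b → MaximalOuterplanar G →
  ∃[ C ] (Accretion G 2 C × (∀ v → v ∈ C))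
maximalOuterplanar-accretion a≢b ((vs , es , fs , D , depicts , f , f∈ , covers) , maximal) =
  outer-face depicts maximal a≢b (reorderFaces (proj₂ (extract f∈)) D) covers

-- Bounds for the indices

accretion-bounds : ∀ {G : Graph n} {k vs} → Accretion G (suc k) vs → (∀ v → v ∈ vs) →
  Σ[ conn ∈ Connected G ]
    ((∀ I → NondecreasingDistanceBased I → I ⟨ G , conn ⟩ ≤ I (power (P n) (suc k))) ×
     (∀ I → NonincreasingDistanceBased I → I ⟨ G , conn ⟩ ≥ I (power (P n) (suc k))))
accretion-bounds {G = G} a all = conn , nondecreasing-bound conn a all , nonincreasing-bound conn a all
  where
  conn : Connected G
  conn u v = accretion-connected G a (all u) (all v)

corollary1 : (∀ (n : ℕ) → n ≥ⁿ 3 → (G : Graph n) → MaximalOuterplanar G →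
    Σ[ conn ∈ Connected G ]
    ((∀ (I : TopologicalIndex) → NondecreasingDistanceBased I →
    I ⟨ G , conn ⟩ ≤ I (power (P n) 2)) ×
    (∀ (I : TopologicalIndex) → NonincreasingDistanceBased I →
    I ⟨ G , conn ⟩ ≥ I (power (P n) 2))))
    ×
    (∀ (n : ℕ) → n ≥ⁿ 3 → (G : Graph n) → ApollonianNetwork G →
    Σ[ conn ∈ Connected G ]
    ((∀ (I : TopologicalIndex) → NondecreasingDistanceBased I →
    I ⟨ G , conn ⟩ ≤ I (power (P n) 3)) ×
    (∀ (I : TopologicalIndex) → NonincreasingDistanceBased I →
    I ⟨ G , conn ⟩ ≥ I (power (P n) 3))))
corollary1 =
  -- Matching on the order bound exhibits two distinct vertices, `zero` and `suc zero`.
  (λ { _ (s≤s (s≤s _)) G maximal →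
       let _ , a , all = maximalOuterplanar-accretion {a = zero} {b = suc zero} (λ ()) maximal
       in accretion-bounds a all }) ,
  (λ _ _ G (_ , _ , _ , stacking , covered , edges) →
     accretion-bounds (stacking-accretion G stacking (Equivalence.from (edges _ _) ∘ inj₁)) covered)
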